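{- (a) Let $M$ be a metric space that is quasi-isometric to a geodesic metric space and is not quasi-isometric to a point, a ray or a line. Then $\operatorname{Br}(M)\ge 3$. (b) Let $M$ be a uniformly discrete metric space that is quasi-isometric to a geodesic metric space. Then $\operatorname{Br}(M)=2$ if and only if $M$ is either bounded or quasi-isometric to a ray or to a line.
   Context: All orders are total orders. Let $(M,d)$ be a (non-empty) metric space. For a finite subset $X\subset M$, $l_{\mathrm{opt}}(X)$ is the minimum of $\sum_{i=1}^{m-1} d(y_i,y_{i+1})$ over all enumerations $y_1,\dots,y_m$ of $X$. If $T$ is an order on $M$ and $x_1<_T\dots<_T x_m$ are the points of $X$, put $l_T(X)=\sum_{i=1}^{m-1} d(x_i,x_{i+1})$. If $M$ has at least two points, then for $k\ge 1$ $$\operatorname{OR}_{M,T}(k)=\sup_{X\subset M,\ 2\le \#X\le k+1}\frac{l_T(X)}{l_{\mathrm{opt}}(X)};$$ if $M$ is a single point, $\operatorname{OR}_{M,T}(k)=1$ for all $k\ge1$. The order breakpoint $\operatorname{Br}(M,T)$ is the smallest integer $s\ge 1$ such that $\operatorname{OR}_{M,T}(s)<s$ ($\infty$ if no such $s$ exists), and $\operatorname{Br}(M)=\min_T \operatorname{Br}(M,T)$ over all orders $T$ on $M$. A metric space is uniformly discrete if there is $\delta>0$ such that any two distinct points are at distance at least $\delta$. A map $\alpha:N\to M$ is a quasi-isometric embedding if there are $C_1\ge1$, $C_2\ge0$ with $\frac1{C_1}d_N(x_1,x_2)-C_2\le d_M(\alpha(x_1),\alpha(x_2))\le C_1d_N(x_1,x_2)+C_2$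 for all $x_1,x_2\in N$; it is a quasi-isometry if moreover $M$ is at bounded distance from $\alpha(N)$. -}

module Defs where

open import Algebra.Bundles using (CommutativeRing)
import Algebra.Construct.NaturalChoice.Max as Max
import Algebra.Definitions.RawMonoid as RawMonoidDefs
import Algebra.Properties.AbelianGroup as AbelianGroupProperties
open import Data.List.Base using (List; []; _∷_; length)
import Data.List.Relation.Binary.Permutation.Setoid as Permutation
open import Data.List.Relation.Unary.Linked using (Linked)
import Data.List.Relation.Unary.Unique.Setoid as Unique
import Data.Nat.Base as ℕ
open import Data.Nat.Base using (ℕ)
open import Data.Product.Base using (Σ; ∃; ∃-syntax; _×_; _,_; proj₁)
open import Data.Sum.Base using (_⊎_; inj₁; inj₂)
open import Function.Bundles using (_⟶ₛ_; _⟨$⟩_)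
import Function.Metric.Definitions as MetricDefs
open import Function.Metric.Structures using (IsGeneralMetric)
open import Level using (Level; suc)
open import Relation.Binary.Bundles using (Setoid; TotalOrder)
import Relation.Binary.Construct.Add.Supremum.NonStrict as AddSupremum
import Relation.Binary.Construct.NonStrictToStrict as ToStrict
import Relation.Binary.Construct.On as On
open import Relation.Binary.Core using (Rel)
open import Relation.Binary.Structures using (IsTotalOrder)
import Relation.Binary.Reasoning.PartialOrder as PosetReasoning
import Relation.Binary.Reasoning.Setoid as SetoidReasoning
open import Relation.Nullary.Construct.Add.Supremum using (_⁺; [_]; ⊤⁺)
open import Relation.Nullary.Negation.Core using (¬_)

private
  variable
    ℓ : Level

-- The real numbers, characterised (uniquely up to isomorphism) as a
-- Dedekind-complete ordered field.  The inverse is total, with an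
-- unspecified value at 0#.

record CompleteOrderedField (ℓ : Level) : Set (suc ℓ) where
  infix  4 _≤_ _<_
  infix  8 _⁻¹

  field
    commutativeRing : CommutativeRing ℓ ℓ

  open CommutativeRing commutativeRing public

  field
    _≤_          : Rel Carrier ℓ
    isTotalOrder : IsTotalOrder _≈_ _≤_
    0≉1          : ¬ (0# ≈ 1#)
    _⁻¹          : Carrier → Carrier
    *-inverseʳ   : ∀ x → ¬ (x ≈ 0#) → x * x ⁻¹ ≈ 1#
    +-monoˡ-≤    : ∀ z {x y} → x ≤ y → x + z ≤ y + z
    *-nonNeg     : ∀ {x y} → 0# ≤ x → 0# ≤ y → 0# ≤ x * y

  _<_ : Rel Carrier ℓ
  _<_ = ToStrict._<_ _≈_ _≤_

  IsUpperBound : (Carrier → Set ℓ) → Carrier → Set ℓ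
  IsUpperBound P b = ∀ x → P x → x ≤ b

  IsSupremum : (Carrier → Set ℓ) → Carrier → Set ℓ
  IsSupremum P s = IsUpperBound P s × (∀ b → IsUpperBound P b → s ≤ b)

  IsMinimum : (Carrier → Set ℓ) → Carrier → Set ℓ
  IsMinimum P m = P m × (∀ x → P x → m ≤ x)

  field
    complete : (P : Carrier → Set ℓ) → ∃ P → ∃ (IsUpperBound P) → ∃ (IsSupremum P)

  totalOrder : TotalOrder ℓ ℓ ℓ
  totalOrder = record { isTotalOrder = isTotalOrder }

  fromℕ : ℕ → Carrier
  fromℕ n = n · 1#
    where open RawMonoidDefs +-rawMonoid using () renaming (_×_ to _·_)

record MetricSpace (R : CompleteOrderedField ℓ) : Set (suc ℓ) where
  private
    module ℝ = CompleteOrderedField R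

  field
    setoid : Setoid ℓ ℓ

  open Setoid setoid public using (Carrier; _≈_)

  field
    d        : Carrier → Carrier → ℝ.Carrier
    isMetric : IsGeneralMetric _≈_ ℝ._≈_ ℝ._≤_ ℝ.0# ℝ._+_ d

module _ {R : CompleteOrderedField ℓ} where

  Subspace : (M : MetricSpace R) → (MetricSpace.Carrier M → Set ℓ) → MetricSpace R
  Subspace M P = record
    { setoid   = record { isEquivalence = On.isEquivalence proj₁ isEquivalence }
    ; d        = λ x y → d (proj₁ x) (proj₁ y)
    ; isMetric = record
      { isSemiMetric = record
        { isQuasiSemiMetric = record
          { isPreMetric = record
            { isProtoMetric = record
              { isPartialOrder  = isPartialOrder
              ; ≈-isEquivalence = On.isEquivalence {B = Σ Carrier P} proj₁ isEquivalence
              ; cong            = cong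
              ; nonNegative     = nonNegative
              }
            ; ≈⇒0 = ≈⇒0
            }
          ; 0⇒≈ = 0⇒≈
          }
        ; sym = λ x y → sym (proj₁ x) (proj₁ y)
        }
      ; triangle = λ x y z → triangle (proj₁ x) (proj₁ y) (proj₁ z)
      }
    }
    where
    open MetricSpace M
    open Setoid setoid using (isEquivalence)
    open IsGeneralMetric isMetric
      using (isPartialOrder; cong; nonNegative; ≈⇒0; 0⇒≈; sym; triangle)

module _ (R : CompleteOrderedField ℓ) where
  open CompleteOrderedField R
  open Max totalOrder using (_⊔_; ⊔-cong; ⊔-comm; ⊔-idem; ⊔-lub; x≤x⊔y; x≤y⊔x)
  open TotalOrder totalOrder using (poset; total)
    renaming (trans to ≤-trans; reflexive to ≤-reflexive; antisym to ≤-antisym)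
  open AbelianGroupProperties +-abelianGroup using (⁻¹-anti-homo‿-)

  -- |x - y|
  dist : Carrier → Carrier → Carrier
  dist x y = (x - y) ⊔ (y - x)

  private

    +-mono-≤ : ∀ {a b x y} → a ≤ b → x ≤ y → a + x ≤ b + y
    +-mono-≤ {a} {b} {x} {y} a≤b x≤y = begin
      a + x ≤⟨ +-monoˡ-≤ x a≤b ⟩
      b + x ≈⟨ +-comm b x ⟩
      x + b ≤⟨ +-monoˡ-≤ b x≤y ⟩
      y + b ≈⟨ +-comm y b ⟩
      b + y ∎
      where open PosetReasoning poset

    telescope : ∀ x y w → (x - y) + (y + w) ≈ x + w
    telescope x y w = begin
      (x - y) + (y + w)   ≈⟨ +-assoc x (- y) (y + w) ⟩
      x + (- y + (y + w)) ≈⟨ +-congˡ (+-assoc (- y) y w) ⟨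
      x + ((- y + y) + w) ≈⟨ +-congˡ (+-congʳ (-‿inverseˡ y)) ⟩
      x + (0# + w)        ≈⟨ +-congˡ (+-identityˡ w) ⟩
      x + w               ∎
      where open SetoidReasoning (CommutativeRing.setoid commutativeRing)

    -‿cong₂ : ∀ {x y u v} → x ≈ y → u ≈ v → x - u ≈ y - v
    -‿cong₂ p q = +-cong p (-‿cong q)

    ≤⇒0≤- : ∀ {x y} → y ≤ x → 0# ≤ x - y
    ≤⇒0≤- {x} {y} y≤x = ≤-trans (≤-reflexive (sym (-‿inverseʳ y))) (+-monoˡ-≤ (- y) y≤x)

    -≤0⇒≤ : ∀ {x y} → x - y ≤ 0# → x ≤ y
    -≤0⇒≤ {x} {y} p = begin
      x                  ≈⟨ +-identityʳ x ⟨
      x + 0#             ≈⟨ telescope x y 0# ⟨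
      (x - y) + (y + 0#) ≤⟨ +-monoˡ-≤ (y + 0#) p ⟩
      0# + (y + 0#)      ≈⟨ +-identityˡ (y + 0#) ⟩
      y + 0#             ≈⟨ +-identityʳ y ⟩
      y                  ∎
      where open PosetReasoning poset

    dist-nonNeg : ∀ {x y} → 0# ≤ dist x y
    dist-nonNeg {x} {y} with total y x
    ... | inj₁ y≤x = ≤-trans (≤⇒0≤- y≤x) (x≤x⊔y (x - y) (y - x))
    ... | inj₂ x≤y = ≤-trans (≤⇒0≤- x≤y) (x≤y⊔x (x - y) (y - x))

    dist-definite : ∀ {x y} → x ≈ y → dist x y ≈ 0#
    dist-definite {x} {y} x≈y = trans
      (⊔-cong (trans (+-congʳ x≈y) (-‿inverseʳ y)) (trans (+-congʳ (sym x≈y)) (-‿inverseʳ x)))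
      (⊔-idem 0#)

    dist-indiscernable : ∀ {x y} → dist x y ≈ 0# → x ≈ y
    dist-indiscernable {x} {y} p = ≤-antisym
      (-≤0⇒≤ (≤-trans (x≤x⊔y (x - y) (y - x)) (≤-reflexive p)))
      (-≤0⇒≤ (≤-trans (x≤y⊔x (x - y) (y - x)) (≤-reflexive p)))

    dist-triangle : ∀ x y z → dist x z ≤ dist x y + dist y z
    dist-triangle x y z = ⊔-lub
      (≤-trans (≤-reflexive (sym (telescope x y (- z))))
        (+-mono-≤ (x≤x⊔y (x - y) (y - x)) (x≤x⊔y (y - z) (z - y))))
      (≤-trans (≤-reflexive (trans (sym (telescope z y (- x))) (+-comm (z - y) (y - x))))
        (+-mono-≤ (x≤y⊔x (x - y) (y - x)) (x≤y⊔x (y - z) (z - y))))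

  Line : MetricSpace R
  Line = record
    { setoid   = CommutativeRing.setoid commutativeRing
    ; d        = dist
    ; isMetric = record
      { isSemiMetric = record
        { isQuasiSemiMetric = record
          { isPreMetric = record
            { isProtoMetric = record
              { isPartialOrder  = IsTotalOrder.isPartialOrder isTotalOrder
              ; ≈-isEquivalence = CommutativeRing.isEquivalence commutativeRing
              ; cong            = λ p q → ⊔-cong (-‿cong₂ p q) (-‿cong₂ q p)
              ; nonNegative     = dist-nonNeg
              }
            ; ≈⇒0 = dist-definite
            }
          ; 0⇒≈ = dist-indiscernable
          }
        ; sym = λ x y → ⊔-comm (x - y) (y - x)
        }
      ; triangle = dist-triangle
      }
    }

  Ray : MetricSpace R
  Ray = Subspace Line (0# ≤_)

  Interval : Carrier → MetricSpace R
  Interval b = Subspace Line (λ t → 0# ≤ t × t ≤ b)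

  Point : MetricSpace R
  Point = Subspace Line (_≈ 0#)

module _ {R : CompleteOrderedField ℓ} where
  private
    module ℝ = CompleteOrderedField R
  open CompleteOrderedField R using (0#; 1#; _+_; _*_; _-_; _≤_; _<_; _⁻¹)
  open MetricSpace using (Carrier; setoid; d)

  IsGeodesic : MetricSpace R → Set ℓ
  IsGeodesic M = ∀ (x y : Carrier M) →
    Σ (setoid (Interval R (d M x y)) ⟶ₛ setoid M) λ γ →
      (∀ s t → d M (γ ⟨$⟩ s) (γ ⟨$⟩ t) ℝ.≈ d (Interval R (d M x y)) s t) ×
      (∀ t → proj₁ t ℝ.≈ 0# → MetricSpace._≈_ M (γ ⟨$⟩ t) x) ×
      (∀ t → proj₁ t ℝ.≈ d M x y → MetricSpace._≈_ M (γ ⟨$⟩ t) y)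

  IsBounded : MetricSpace R → Set ℓ
  IsBounded M = MetricDefs.Bounded _≤_ (d M)

  IsUniformlyDiscrete : MetricSpace R → Set ℓ
  IsUniformlyDiscrete M = ∃[ δ ] 0# < δ ×
    (∀ x y → ¬ MetricSpace._≈_ M x y → δ ≤ d M x y)

  IsQuasiIsometricEmbedding : (N M : MetricSpace R) → (setoid N ⟶ₛ setoid M) → Set ℓ
  IsQuasiIsometricEmbedding N M α = ∃[ C₁ ] ∃[ C₂ ] 1# ≤ C₁ × 0# ≤ C₂ ×
    (∀ x₁ x₂ → C₁ ⁻¹ * d N x₁ x₂ - C₂ ≤ d M (α ⟨$⟩ x₁) (α ⟨$⟩ x₂) ×
               d M (α ⟨$⟩ x₁) (α ⟨$⟩ x₂) ≤ C₁ * d N x₁ x₂ + C₂)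

  IsQuasiIsometry : (N M : MetricSpace R) → (setoid N ⟶ₛ setoid M) → Set ℓ
  IsQuasiIsometry N M α = IsQuasiIsometricEmbedding N M α ×
    (∃[ D ] ∀ y → ∃[ x ] d M y (α ⟨$⟩ x) ≤ D)

  QuasiIsometric : MetricSpace R → MetricSpace R → Set ℓ
  QuasiIsometric N M = ∃ (IsQuasiIsometry N M)

ℕ∞ : Set
ℕ∞ = ℕ ⁺

open AddSupremum ℕ._≤_ public using () renaming (_≤⁺_ to _≤∞_)

-- Suprema, minima and breakpoints are given as functional relations:
-- IsOptLength M X r, IsOrderLength M T X r, IsOR M T k r, IsBrOf M T b
-- and IsBr M b say that l_opt(X), l_T(X), OR_{M,T}(k), Br(M,T) and
-- Br(M), respectively, exist and have the value given last.

module _ {R : CompleteOrderedField ℓ} (M : MetricSpace R) where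
  private
    module ℝ = CompleteOrderedField R
  open MetricSpace M
  open Permutation setoid using (_↭_)

  record Order : Set (suc ℓ) where
    field
      _≤ₜ_         : Rel Carrier ℓ
      isTotalOrder : IsTotalOrder _≈_ _≤ₜ_

    _<ₜ_ : Rel Carrier ℓ
    _<ₜ_ = ToStrict._<_ _≈_ _≤ₜ_

  pathLength : List Carrier → ℝ.Carrier
  pathLength []           = ℝ.0#
  pathLength (_ ∷ [])     = ℝ.0#
  pathLength (x ∷ y ∷ zs) = d x y ℝ.+ pathLength (y ∷ zs)

  -- A finite subset is given by a repetition-free list X; its
  -- enumerations are the lists ys with ys ↭ X.

  IsOptLength : List Carrier → ℝ.Carrier → Set ℓ
  IsOptLength X = ℝ.IsMinimum (λ r → ∃[ ys ] ys ↭ X × r ℝ.≈ pathLength ys)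

  module _ (T : Order) where
    open Order T using (_<ₜ_)

    IsOrderLength : List Carrier → ℝ.Carrier → Set ℓ
    IsOrderLength X r = ∃[ ys ] ys ↭ X × Linked _<ₜ_ ys × r ℝ.≈ pathLength ys

    IsRatio : ℕ → ℝ.Carrier → Set ℓ
    IsRatio k q = ∃[ X ] Unique.Unique setoid X ×
      2 ℕ.≤ length X × length X ℕ.≤ k ℕ.+ 1 ×
      (∃[ l ] ∃[ o ] IsOrderLength X l × IsOptLength X o × q ℝ.≈ l ℝ.* o ℝ.⁻¹)

    IsOR : ℕ → ℝ.Carrier → Set ℓ
    IsOR k r =
      ((∃[ x ] ∃[ y ] ¬ x ≈ y) × ℝ.IsSupremum (IsRatio k) r) ⊎
      ((∃[ x ] ∀ y → x ≈ y) × r ℝ.≈ ℝ.1#)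

    IsBreaking : ℕ → Set ℓ
    IsBreaking s = 1 ℕ.≤ s × (∃[ r ] IsOR s r × r ℝ.< ℝ.fromℕ s)

    IsBrOf : ℕ∞ → Set ℓ
    IsBrOf [ s ] = IsBreaking s × (∀ s′ → IsBreaking s′ → s ℕ.≤ s′)
    IsBrOf ⊤⁺    = ∀ s → ¬ IsBreaking s

  IsBr : ℕ∞ → Set (suc ℓ)
  IsBr b = (∃[ T ] IsBrOf T b) × (∀ T b′ → IsBrOf T b′ → b ≤∞ b′)

{-# OPTIONS --safe #-}
module Submission where

import Algebra.Construct.NaturalChoice.Max as Max
import Algebra.Properties.Ring as RingProperties
import Algebra.Solver.Ring.NaturalCoefficients.Default as NaturalCoefficients
open import Axiom.ExcludedMiddle using (ExcludedMiddle)
open import Axiom.Extensionality.Propositional using (Extensionality)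
open import Data.Bool.Base using (Bool; true; false; T)
open import Data.Empty using (⊥-elim)
open import Data.List.Base using (List; []; _∷_; length; foldr; map)
import Data.List.Membership.Setoid as Membership
import Data.List.Relation.Binary.Permutation.Setoid as Permutation
import Data.List.Relation.Binary.Permutation.Setoid.Properties as PermutationProperties
open import Data.List.Relation.Unary.All using ([]; _∷_)
open import Data.List.Relation.Unary.AllPairs using ([]; _∷_)
open import Data.List.Relation.Unary.Any using (here; there)
open import Data.List.Relation.Unary.Linked using (Linked; [-]; _∷_)
import Data.List.Relation.Unary.Unique.Setoid as Unique
import Data.Nat.Base as ℕ
open import Data.Nat.Base using (ℕ; z≤n; s≤s)
open import Data.Nat.Induction using (<-rec)
import Data.Nat.Properties as ℕ
open import Data.Product.Base using (∃; ∃-syntax; _×_; _,_; proj₁; proj₂)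
open import Data.Product.Relation.Binary.Lex.NonStrict using (×-Lex; ×-isTotalOrder)
open import Data.Sum.Base as Sum using (_⊎_; inj₁; inj₂; [_,_]′)
open import Data.Unit.Base using (⊤; tt)
open import Function.Base using (_∘_; case_of_)
open import Function.Bundles using (_⟶ₛ_; _⟨$⟩_; Func; _⇔_; mk⇔)
open import Function.Metric.Structures using (IsGeneralMetric)
open import Relation.Binary.Bundles using (Setoid; TotalOrder)
open import Relation.Binary.Construct.Add.Supremum.NonStrict ℕ._≤_ using (_≤⊤⁺) renaming ([_] to [_]≤)
import Relation.Binary.Construct.On as On
open import Relation.Binary.PropositionalEquality.Core as ≡ using (_≡_)
import Relation.Binary.Reasoning.PartialOrder as PosetReasoning
import Relation.Binary.Reasoning.Setoid as SetoidReasoning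
open import Relation.Binary.Structures using (IsTotalOrder)
open import Relation.Nullary.Construct.Add.Supremum using ([_]; ⊤⁺)
open import Relation.Nullary.Decidable.Core using (yes; no; ⌊_⌋; toWitness; fromWitness)
open import Relation.Nullary.Negation.Core using (¬_)
open import Defs

-- OR(2) < 2 says that d(x, y) ≤ λ d(x, z) for some constant λ and all
-- x ≤ y ≤ z.  Suppose this, and let p be the distance in the geodesic space.
-- A geodesic from x to z must jump over every y between them in the order, so
-- it passes near y, and p(x, y) + p(y, z) ≤ p(x, z) + E.  Fix o: then
-- x ↦ ± p(o, x), with the sign given by the side of o on which x lies, is an
-- isometry into the line up to an additive error.  Its image is coarsely a
-- bounded set, a ray or the line.
-- Conversely, ordering M by a quasi-isometric embedding into the line gives
-- d(x, y), d(y, z) ≤ B₁ d(x, z) + B₂ for x ≤ y ≤ z, and uniform discreteness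
-- absorbs B₂; this keeps OR(2) away from 2.

-- No breakpoint is below 2, since OR(1) is never below 1; both parts therefore ask whether some
-- order has OR(2) < 2. Only sets of two or three points enter OR(2). A path through three points is
-- determined up to reversal by its middle point, so the optimum is a minimum over centres, and
-- OR(2) < 2 becomes a triangle estimate with explicit constants in both directions: a gap `2 - r`
-- yields `λ₀`, and a factor `μ` yields the ratio `2 - 1/(1 + μ)`. The additive estimates concern
-- `p` and not `d`, because the factor `C₁` between the two would spoil a comparison with
-- coefficient 1. An order on M must exist to begin with. Part (a) asserts that Br(M) has a value,
-- and if no order breaks, some order has to attain infinity; in part (b) the coordinate on M need
-- not be injective, and its fibres have to be ordered too. Hence Zermelo's construction, from
-- excluded middle and extensionality.

-- Existence of a total order on an arbitrary setoid.

module OrderingPrinciple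
  (em : ∀ {a} → ExcludedMiddle a) (ext : ∀ {a b} → Extensionality a b)
  {ℓ} (S : Setoid ℓ ℓ) (x₀ : Setoid.Carrier S) where

  open Setoid S

  Subset : Set ℓ
  Subset = Carrier → Bool

  private
    variable
      P Q : Subset
      x y : Carrier

  infix 4 _⊆_

  _⊆_ : Subset → Subset → Set ℓ
  P ⊆ Q = ∀ {x} → T (P x) → T (Q x)

  ⊆-antisym : P ⊆ Q → Q ⊆ P → P ≡ Q
  ⊆-antisym {P} {Q} P⊆Q Q⊆P = ext λ x → T-injective (P x) (Q x) P⊆Q Q⊆P
    where
    T-injective : ∀ b c → (T b → T c) → (T c → T b) → b ≡ c
    T-injective true  true  f g = ≡.refl
    T-injective true  false f g = ⊥-elim (f _)
    T-injective false true  f g = ⊥-elim (g _)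
    T-injective false false f g = ≡.refl

  -- Excluded middle for untruncated types yields witnesses, hence choice;
  -- Bool-valued subsets make the choice extensional.
  choose : Subset → Carrier
  choose P with em {P = ∃ λ x → T (P x)}
  ... | yes (x , _) = x
  ... | no  _       = x₀

  choose-∈ : T (P x) → T (P (choose P))
  choose-∈ {P} x∈P with em {P = ∃ λ x → T (P x)}
  ... | yes (_ , y∈P) = y∈P
  ... | no  P-empty   = ⊥-elim (P-empty (_ , x∈P))

  remove : Subset → Subset
  remove P x = ⌊ em {P = T (P x) × ¬ x ≈ choose P} ⌋

  ∈-remove⁺ : T (P x) → ¬ x ≈ choose P → T (remove P x)
  ∈-remove⁺ x∈P x≉c = fromWitness {a? = em} (x∈P , x≉c)

  ∈-remove⁻ : T (remove P x) → T (P x) × ¬ x ≈ choose P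
  ∈-remove⁻ = toWitness {a? = em}

  -- Families are `Bool`-valued to keep `Tower` and `_≼_` at level `ℓ`, as `Order` requires. The
  -- empty family gives the whole space, the top of the tower.
  ⋂ : (Subset → Bool) → Subset
  ⋂ F x = ⌊ em {P = ∀ P → T (F P) → T (P x)} ⌋

  -- Zermelo's chain, read downwards: the chosen points are removed one
  -- after the other, and x ≼ y when y is not removed before x.
  data Tower : Subset → Set ℓ where
    shrink : Tower P → Tower (remove P)
    meet   : ∀ F → (∀ P → T (F P) → Tower P) → Tower (⋂ F)

  tower-resp-≈ : Tower P → x ≈ y → T (P x) → T (P y)
  tower-resp-≈ (shrink p) x≈y x∈ with x∈P , x≉c ← ∈-remove⁻ x∈ =
    ∈-remove⁺ (tower-resp-≈ p x≈y x∈P) (x≉c ∘ trans x≈y)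
  tower-resp-≈ (meet F ps) x≈y x∈ = fromWitness {a? = em} λ P P∈F →
    tower-resp-≈ (ps P P∈F) x≈y (toWitness {a? = em} x∈ P P∈F)

  Comparable : Subset → Set ℓ
  Comparable P = ∀ {Q} → Tower Q → P ⊆ Q ⊎ Q ⊆ P

  -- No tower set fits strictly between `remove P` and `P`. In the shrinking case `P` is squeezed
  -- between `remove Q` and `Q`, which differ in the single point `choose Q`, so it only matters
  -- whether `P` contains that point.
  comparable-remove : Tower P → Comparable P → Tower Q → P ⊆ Q ⊎ Q ⊆ remove P
  comparable-remove {P} p P-comp (shrink {Q} q) with comparable-remove p P-comp q
  ... | inj₂ Q⊆ = inj₂ (Q⊆ ∘ proj₁ ∘ ∈-remove⁻)
  ... | inj₁ P⊆Q with P-comp (shrink q) | em {P = T (P (choose Q))}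
  ...   | inj₁ P⊆ | _       = inj₁ P⊆
  ...   | inj₂ ⊆P | no c∉P  = inj₁ λ x∈P →
    ∈-remove⁺ (P⊆Q x∈P) λ x≈c → c∉P (tower-resp-≈ p x≈c x∈P)
  -- Here `P` and `Q` are the same subset. The removed point is a function of the subset, so the
  -- equality supplied by extensionality identifies `remove Q` with `remove P`.
  ...   | inj₂ ⊆P | yes c∈P = inj₂ (≡.subst (λ P → remove Q ⊆ remove P) (⊆-antisym Q⊆P P⊆Q) λ x∈ → x∈)
    where
    Q⊆P : Q ⊆ P
    Q⊆P {x} x∈Q with em {P = x ≈ choose Q}
    ... | yes x≈c = tower-resp-≈ p (sym x≈c) c∈P
    ... | no  x≉c = ⊆P (∈-remove⁺ x∈Q x≉c)
  comparable-remove {P} p P-comp (meet F qs) with em {P = ∃[ Q ] T (F Q) × Q ⊆ remove P}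
  ... | yes (Q , Q∈F , Q⊆) = inj₂ λ x∈ → Q⊆ (toWitness {a? = em} x∈ Q Q∈F)
  ... | no  none = inj₁ λ {x} x∈P → fromWitness {a? = em} λ Q Q∈F → P⊆ Q Q∈F x∈P
    where
    P⊆ : ∀ Q → T (F Q) → P ⊆ Q
    P⊆ Q Q∈F with comparable-remove p P-comp (qs Q Q∈F)
    ... | inj₁ P⊆Q = P⊆Q
    ... | inj₂ Q⊆  = ⊥-elim (none (Q , Q∈F , λ {x} → Q⊆ {x}))

  tower-total : Tower P → Comparable P
  tower-total (shrink p) q with comparable-remove p (tower-total p) q
  ... | inj₁ P⊆Q = inj₁ (P⊆Q ∘ proj₁ ∘ ∈-remove⁻)
  ... | inj₂ Q⊆  = inj₂ Q⊆
  tower-total (meet F ps) {Q} q with em {P = ∃[ P ] T (F P) × P ⊆ Q}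
  ... | yes (P , P∈F , P⊆Q) = inj₁ λ x∈ → P⊆Q (toWitness {a? = em} x∈ P P∈F)
  ... | no  none = inj₂ λ x∈Q → fromWitness {a? = em} λ P P∈F → Q⊆ P P∈F x∈Q
    where
    Q⊆ : ∀ P → T (F P) → Q ⊆ P
    Q⊆ P P∈F with tower-total (ps P P∈F) q
    ... | inj₁ P⊆Q = ⊥-elim (none (P , P∈F , λ {x} → P⊆Q {x}))
    ... | inj₂ Q⊆P = Q⊆P

  infix 4 _≼_

  _≼_ : Carrier → Carrier → Set ℓ
  x ≼ y = ∀ P → Tower P → T (P x) → T (P y)

  ≼-total : ∀ x y → x ≼ y ⊎ y ≼ x
  ≼-total x y with em {P = x ≼ y}
  ... | yes x≼y = inj₁ x≼y
  ... | no  x⋠y = inj₂ y≼x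
    where
    y≼x : y ≼ x
    y≼x Q q y∈Q with em {P = T (Q x)}
    ... | yes x∈Q = x∈Q
    ... | no  x∉Q = ⊥-elim (x⋠y x≼y)
      where
      x≼y : x ≼ y
      x≼y P p x∈P with tower-total p q
      ... | inj₁ P⊆Q = ⊥-elim (x∉Q (P⊆Q x∈P))
      ... | inj₂ Q⊆P = Q⊆P y∈Q

  -- The intersection of the tower sets containing x loses x when it is
  -- shrunk, so its chosen point is x; by symmetry it is also y.
  ≼-antisym : x ≼ y → y ≼ x → x ≈ y
  ≼-antisym {x} {y} x≼y y≼x = trans x≈c (sym y≈c)
    where
    containing-x : Subset → Bool
    containing-x P = ⌊ em {P = Tower P × T (P x)} ⌋

    P₀ : Subset
    P₀ = ⋂ containing-x

    p₀ : Tower P₀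
    p₀ = meet containing-x λ P P∈ → proj₁ (toWitness {a? = em} P∈)

    x∈P₀ : T (P₀ x)
    x∈P₀ = fromWitness {a? = em} λ P P∈ → proj₂ (toWitness {a? = em} P∈)

    x∉remove : ¬ T (remove P₀ x)
    x∉remove x∈ = proj₂ (∈-remove⁻ c∈) refl
      where
      c∈ : T (remove P₀ (choose P₀))
      c∈ = toWitness {a? = em} (choose-∈ {P₀} x∈P₀) (remove P₀) (fromWitness {a? = em} (shrink p₀ , x∈))

    x≈c : x ≈ choose P₀
    x≈c with em {P = x ≈ choose P₀}
    ... | yes p = p
    ... | no  x≉c = ⊥-elim (x∉remove (∈-remove⁺ x∈P₀ x≉c))

    y≈c : y ≈ choose P₀
    y≈c with em {P = y ≈ choose P₀}
    ... | yes p = p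
    ... | no  y≉c = ⊥-elim (x∉remove (y≼x _ (shrink p₀) (∈-remove⁺ (x≼y _ p₀ x∈P₀) y≉c)))

  ≼-isTotalOrder : IsTotalOrder _≈_ _≼_
  ≼-isTotalOrder = record
    { isPartialOrder = record
      { isPreorder = record
        { isEquivalence = isEquivalence
        ; reflexive     = λ x≈y P p → tower-resp-≈ p x≈y
        ; trans         = λ x≼y y≼z P p → y≼z P p ∘ x≼y P p
        }
      ; antisym = ≼-antisym
      }
    ; total = ≼-total
    }

-- Inequalities in a complete ordered field.

module OrderedField {ℓ} (R : CompleteOrderedField ℓ) where
  open CompleteOrderedField R
  open TotalOrder totalOrder public using (poset; total)
    renaming (trans to ≤-trans; reflexive to ≤-reflexive; antisym to ≤-antisym; refl to ≤-refl)
  open NaturalCoefficients commutativeSemiring public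
    using (solve; _:=_; _:+_; _:*_; con)
  open RingProperties ring using (-1*x≈-x; -‿involutive)
  open Max totalOrder public using (x≤x⊔y; x≤y⊔x; ⊔-lub)

  infixr 5 _⊕_
  infixr 7 _⊛_

  _⊕_ : ∀ {a b x y} → a ≤ b → x ≤ y → a + x ≤ b + y
  _⊕_ {a} {b} {x} {y} a≤b x≤y = begin
    a + x ≤⟨ +-monoˡ-≤ x a≤b ⟩
    b + x ≈⟨ +-comm b x ⟩
    x + b ≤⟨ +-monoˡ-≤ b x≤y ⟩
    y + b ≈⟨ +-comm y b ⟩
    b + y ∎
    where open PosetReasoning poset

  +-cancelʳ-≤ : ∀ z {x y} → x + z ≤ y + z → x ≤ y
  +-cancelʳ-≤ z {x} {y} x+z≤y+z = begin
    x           ≈⟨ add-sub x ⟨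
    x + z - z   ≤⟨ +-monoˡ-≤ (- z) x+z≤y+z ⟩
    y + z - z   ≈⟨ add-sub y ⟩
    y           ∎
    where
    open PosetReasoning poset
    add-sub : ∀ x → x + z - z ≈ x
    add-sub x = trans (+-assoc x z (- z)) (trans (+-congˡ (-‿inverseʳ z)) (+-identityʳ x))

  -- x ≤ y follows from a ≤ b as soon as y - x = b - a; with both sides
  -- moved so that no subtraction occurs, this is a semiring identity.
  by-adding : ∀ {a b x y} → a ≤ b → x + b ≈ y + a → x ≤ y
  by-adding {a} {b} {x} {y} a≤b eq = +-cancelʳ-≤ b (≤-trans (≤-reflexive eq) (≤-refl ⊕ a≤b))

  ≤⇒0≤- : ∀ {x y} → x ≤ y → 0# ≤ y - x
  ≤⇒0≤- {x} {y} x≤y = ≤-trans (≤-reflexive (sym (-‿inverseʳ x))) (+-monoˡ-≤ (- x) x≤y)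

  sub-add : ∀ x y → x - y + y ≈ x
  sub-add x y = trans (+-assoc x (- y) y) (trans (+-congˡ (-‿inverseˡ y)) (+-identityʳ x))

  _⊛_ : ∀ {z x y} → 0# ≤ z → x ≤ y → z * x ≤ z * y
  _⊛_ {z} {x} {y} 0≤z x≤y = by-adding (*-nonNeg 0≤z (≤⇒0≤- x≤y))
    (trans (sym (distribˡ z x (y - x)))
      (trans (*-congˡ (trans (+-comm x (y - x)) (sub-add y x))) (sym (+-identityʳ (z * y)))))

  ≤⇒≯ : ∀ {x y} → x ≤ y → ¬ y < x
  ≤⇒≯ x≤y (y≤x , y≉x) = y≉x (≤-antisym y≤x x≤y)

  <-≤-trans : ∀ {x y z} → x < y → y ≤ z → x < z
  <-≤-trans x<y@(x≤y , _) y≤z = ≤-trans x≤y y≤z ,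
    λ x≈z → ≤⇒≯ (≤-trans y≤z (≤-reflexive (sym x≈z))) x<y

  ≤-<-trans : ∀ {x y z} → x ≤ y → y < z → x < z
  ≤-<-trans x≤y y<z@(y≤z , _) = ≤-trans x≤y y≤z ,
    λ x≈z → ≤⇒≯ (≤-trans (≤-reflexive (sym x≈z)) x≤y) y<z

  0≤-neg : ∀ {x} → x ≤ 0# → 0# ≤ - x
  0≤-neg {x} x≤0 = by-adding {x} {0#} x≤0
    (trans (+-identityˡ 0#) (sym (-‿inverseˡ x)))

  0≤1 : 0# ≤ 1#
  0≤1 with total 0# 1#
  ... | inj₁ 0≤1 = 0≤1
  ... | inj₂ 1≤0 = ≤-trans (*-nonNeg (0≤-neg 1≤0) (0≤-neg 1≤0)) (≤-reflexive -1*-1)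
    where
    -1*-1 : - 1# * - 1# ≈ 1#
    -1*-1 = trans (-1*x≈-x (- 1#)) (-‿involutive 1#)

  0<1 : 0# < 1#
  0<1 = 0≤1 , 0≉1

  0<⇒≉0 : ∀ {x} → 0# < x → ¬ x ≈ 0#
  0<⇒≉0 (_ , 0≉x) x≈0 = 0≉x (sym x≈0)

  *-inverseˡ : ∀ x → ¬ x ≈ 0# → x ⁻¹ * x ≈ 1#
  *-inverseˡ x x≉0 = trans (*-comm (x ⁻¹) x) (*-inverseʳ x x≉0)

  ⁻¹-nonNeg : ∀ {x} → 0# < x → 0# ≤ x ⁻¹
  ⁻¹-nonNeg {x} 0<x@(0≤x , _) with total 0# (x ⁻¹)
  ... | inj₁ 0≤x⁻¹ = 0≤x⁻¹
  ... | inj₂ x⁻¹≤0 = ⊥-elim (≤⇒≯ 1≤0 0<1)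
    where
    1≤0 : 1# ≤ 0#
    1≤0 = ≤-trans (≤-reflexive (sym (*-inverseʳ x (0<⇒≉0 0<x))))
      (≤-trans (0≤x ⊛ x⁻¹≤0) (≤-reflexive (zeroʳ x)))

  *⁻¹-≤ : ∀ {x y z} → 0# < y → x ≤ z * y → x * y ⁻¹ ≤ z
  *⁻¹-≤ {x} {y} {z} 0<y x≤zy = begin
    x * y ⁻¹       ≈⟨ *-comm x (y ⁻¹) ⟩
    y ⁻¹ * x       ≤⟨ ⁻¹-nonNeg 0<y ⊛ x≤zy ⟩
    y ⁻¹ * (z * y) ≈⟨ solve 3 (λ i z y → i :* (z :* y) := z :* (i :* y)) refl (y ⁻¹) z y ⟩
    z * (y ⁻¹ * y) ≈⟨ *-congˡ (*-inverseˡ y (0<⇒≉0 0<y)) ⟩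
    z * 1#         ≈⟨ *-identityʳ z ⟩
    z              ∎
    where open PosetReasoning poset

  ≤-*⁻¹ : ∀ {x y z} → 0# < y → x * y ⁻¹ ≤ z → x ≤ z * y
  ≤-*⁻¹ {x} {y} {z} 0<y xy⁻¹≤z = begin
    x              ≈⟨ *-identityʳ x ⟨
    x * 1#         ≈⟨ *-congˡ (*-inverseˡ y (0<⇒≉0 0<y)) ⟨
    x * (y ⁻¹ * y) ≈⟨ solve 3 (λ i x y → x :* (i :* y) := y :* (x :* i)) refl (y ⁻¹) x y ⟩
    y * (x * y ⁻¹) ≤⟨ proj₁ 0<y ⊛ xy⁻¹≤z ⟩
    y * z          ≈⟨ *-comm y z ⟩
    z * y          ∎
    where open PosetReasoning poset

  ≤-⁻¹* : ∀ {x y z} → 0# < z → z * x ≤ y → x ≤ z ⁻¹ * y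
  ≤-⁻¹* {x} {y} {z} 0<z zx≤y = begin
    x              ≈⟨ *-identityˡ x ⟨
    1# * x         ≈⟨ *-congʳ (*-inverseˡ z (0<⇒≉0 0<z)) ⟨
    (z ⁻¹ * z) * x ≈⟨ *-assoc (z ⁻¹) z x ⟩
    z ⁻¹ * (z * x) ≤⟨ ⁻¹-nonNeg 0<z ⊛ zx≤y ⟩
    z ⁻¹ * y       ∎
    where open PosetReasoning poset

  ⁻¹*-≤ : ∀ {x y z} → 0# < z → z ⁻¹ * x ≤ y → x ≤ z * y
  ⁻¹*-≤ {x} {y} {z} 0<z z⁻¹x≤y = begin
    x              ≈⟨ *-identityˡ x ⟨
    1# * x         ≈⟨ *-congʳ (*-inverseʳ z (0<⇒≉0 0<z)) ⟨
    (z * z ⁻¹) * x ≈⟨ *-assoc z (z ⁻¹) x ⟩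
    z * (z ⁻¹ * x) ≤⟨ proj₁ 0<z ⊛ z⁻¹x≤y ⟩
    z * y          ∎
    where open PosetReasoning poset

  0≤+ : ∀ {x y} → 0# ≤ x → 0# ≤ y → 0# ≤ x + y
  0≤+ 0≤x 0≤y = ≤-trans (≤-reflexive (sym (+-identityʳ 0#))) (0≤x ⊕ 0≤y)

  x≤x+nonNeg : ∀ {x y} → 0# ≤ y → x ≤ x + y
  x≤x+nonNeg {x} 0≤y = ≤-trans (≤-reflexive (sym (+-identityʳ x))) (≤-refl ⊕ 0≤y)

  ≤-+⇒-≤ : ∀ {x y z} → x ≤ z + y → x - y ≤ z
  ≤-+⇒-≤ {x} {y} {z} x≤z+y = +-cancelʳ-≤ y (≤-trans (≤-reflexive (sub-add x y)) x≤z+y)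

  -≤⇒≤-+ : ∀ {x y z} → x - y ≤ z → x ≤ z + y
  -≤⇒≤-+ {x} {y} x-y≤z = ≤-trans (≤-reflexive (sym (sub-add x y))) (+-monoˡ-≤ y x-y≤z)

  dist-≤ : ∀ {x y e} → x ≤ e + y → y ≤ e + x → dist R x y ≤ e
  dist-≤ {x} {y} {e} p q = ⊔-lub (≤-+⇒-≤ p) (≤-+⇒-≤ q)

  ≤-distˡ : ∀ x y → x ≤ dist R x y + y
  ≤-distˡ x y = -≤⇒≤-+ (x≤x⊔y (x - y) (y - x))

  ≤-distʳ : ∀ x y → y ≤ dist R x y + x
  ≤-distʳ x y = -≤⇒≤-+ (x≤y⊔x (x - y) (y - x))

  module _ (em : ∀ {a} → ExcludedMiddle a) where

    ≰⇒≥ : ∀ {x y} → ¬ x ≤ y → y ≤ x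
    ≰⇒≥ {x} {y} x≰y with total x y
    ... | inj₁ x≤y = ⊥-elim (x≰y x≤y)
    ... | inj₂ y≤x = y≤x

    supremum-approached : ∀ {P : Carrier → Set ℓ} {s ε} → IsSupremum P s → 0# < ε →
      ∃[ t ] P t × s ≤ t + ε
    supremum-approached {P} {s} {ε} (upper , least) 0<ε with em {P = ∃[ t ] P t × s ≤ t + ε}
    ... | yes found = found
    ... | no  none  = ⊥-elim (≤⇒≯ ε≤0 0<ε)
      where
      s-ε-upper : IsUpperBound P (s - ε)
      s-ε-upper t t∈P = ≰⇒≥ λ s-ε≤t → none (t , t∈P , -≤⇒≤-+ s-ε≤t)
      ε≤0 : ε ≤ 0#
      ε≤0 = by-adding s+ε≤s (solve 2 (λ ε s → ε :+ s := con 0 :+ (s :+ ε)) refl ε s)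
        where
        s+ε≤s : s + ε ≤ s
        s+ε≤s = ≤-trans (least (s - ε) s-ε-upper ⊕ ≤-refl) (≤-reflexive (sub-add s ε))

-- Paths through two or three points.

module Paths {ℓ} {R : CompleteOrderedField ℓ} (M : MetricSpace R) where
  private
    module ℝ = CompleteOrderedField R
  open CompleteOrderedField R using (0#; 1#; _+_; _*_; _-_; _≤_; _<_; _⁻¹)
  open OrderedField R
  open MetricSpace M
  open Setoid setoid using (refl; sym)
  open IsGeneralMetric isMetric public
    using (nonNegative; triangle; ≈⇒0; 0⇒≈)
    renaming (cong to d-cong; sym to d-sym)
  open Membership setoid using (_∈_)
  open Permutation setoid using (_↭_; ↭-refl; ↭-sym; ↭-trans; ↭-swap; ↭-prep)
  open PermutationProperties setoid using (∈-resp-↭; Unique-resp-↭; xs↭ys⇒|xs|≡|ys|)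
  open Unique setoid using (Unique)

  -- Unlike a path length, this sum ignores the order of `xs`. Every path through two or three
  -- points has as its length the star at one of them, which turns `l_opt` into a minimum over
  -- centres.
  star : Carrier → List Carrier → ℝ.Carrier
  star q xs = foldr _+_ 0# (map (d q) xs)

  star-↭ : ∀ q {xs ys} → xs ↭ ys → star q xs ℝ.≈ star q ys
  star-↭ q xs↭ys = PermutationProperties.foldr-commMonoid ℝ.setoid ℝ.+-isCommutativeMonoid
    (PermutationProperties.map⁺ setoid ℝ.setoid (d-cong refl) xs↭ys)

  star-cong : ∀ {p q} → p ≈ q → ∀ xs → star p xs ℝ.≈ star q xs
  star-cong p≈q []       = ℝ.refl
  star-cong p≈q (x ∷ xs) = ℝ.+-cong (d-cong p≈q refl) (star-cong p≈q xs)

  star-head : ∀ x xs → star x (x ∷ xs) ℝ.≈ star x xs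
  star-head x xs = ℝ.trans (ℝ.+-congʳ (≈⇒0 refl)) (ℝ.+-identityˡ (star x xs))

  -- Dropping the vanishing summand d y y identifies the length of a path
  -- through three points with a sum that does not depend on their order.
  path₃ : ∀ x y z → pathLength M (x ∷ y ∷ z ∷ []) ℝ.≈ star y (x ∷ y ∷ z ∷ [])
  path₃ x y z = ℝ.+-cong (d-sym x y) (ℝ.sym (star-head y (z ∷ [])))

  Small : List Carrier → Set
  Small xs = 2 ℕ.≤ length xs × length xs ℕ.≤ 3

  Small-↭ : ∀ {xs ys} → xs ↭ ys → Small xs → Small ys
  Small-↭ xs↭ys (2≤ , ≤3) =
    ≡.subst (2 ℕ.≤_) (xs↭ys⇒|xs|≡|ys| xs↭ys) 2≤ , ≡.subst (ℕ._≤ 3) (xs↭ys⇒|xs|≡|ys| xs↭ys) ≤3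

  path-star : ∀ xs → Small xs → ∃[ q ] q ∈ xs × pathLength M xs ℝ.≈ star q xs
  path-star []          (() , _)
  path-star (x ∷ [])    (s≤s () , _)
  path-star (x ∷ y ∷ []) _ = x , here refl , ℝ.sym (star-head x (y ∷ []))
  path-star (x ∷ y ∷ z ∷ []) _ = y , there (here refl) , path₃ x y z
  path-star (_ ∷ _ ∷ _ ∷ _ ∷ _) (_ , s≤s (s≤s (s≤s ())))

  ↭-path-star : ∀ {xs ys} → ys ↭ xs → Small xs → ∃[ q ] q ∈ xs × pathLength M ys ℝ.≈ star q xs
  ↭-path-star ys↭xs xs-small with q , q∈ys , eq ← path-star _ (Small-↭ (↭-sym ys↭xs) xs-small) =
    q , ∈-resp-↭ ys↭xs q∈ys , ℝ.trans eq (star-↭ q ys↭xs)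

  -- Converse of `path-star`: placing `q` in the middle of three points, or first of two, realises
  -- its star as a path, so every centre competes in `l_opt`.
  centred : ∀ {q} xs → q ∈ xs → Small xs → ∃[ ys ] ys ↭ xs × star q xs ℝ.≈ pathLength M ys
  centred (x ∷ []) _ (s≤s () , _)
  centred xs@(x ∷ y ∷ []) (here q≈x) _ =
    xs , ↭-refl , ℝ.trans (star-cong q≈x xs) (star-head x (y ∷ []))
  centred xs@(x ∷ y ∷ []) (there (here q≈y)) _ =
    y ∷ x ∷ [] , ↭-swap y x ↭-refl ,
    ℝ.trans (star-cong q≈y xs) (ℝ.trans (star-↭ y {xs} (↭-swap x y ↭-refl)) (star-head y (x ∷ [])))
  centred xs@(x ∷ y ∷ z ∷ []) (here q≈x) _ =
    y ∷ x ∷ z ∷ [] , ↭-swap y x ↭-refl ,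
    ℝ.trans (star-cong q≈x xs) (ℝ.trans (star-↭ x {xs} (↭-swap x y ↭-refl)) (ℝ.sym (path₃ y x z)))
  centred xs@(x ∷ y ∷ z ∷ []) (there (here q≈y)) _ =
    xs , ↭-refl , ℝ.trans (star-cong q≈y xs) (ℝ.sym (path₃ x y z))
  centred xs@(x ∷ y ∷ z ∷ []) (there (there (here q≈z))) _ =
    x ∷ z ∷ y ∷ [] , ↭-prep x (↭-swap z y ↭-refl) ,
    ℝ.trans (star-cong q≈z xs)
      (ℝ.trans (star-↭ z {xs} (↭-prep x (↭-swap y z ↭-refl))) (ℝ.sym (path₃ x z y)))
  centred (_ ∷ _ ∷ _ ∷ _ ∷ _) _ (_ , s≤s (s≤s (s≤s ())))

  argmin : (f : Carrier → ℝ.Carrier) → (∀ {x y} → x ≈ y → f x ≤ f y) →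
    ∀ x xs → ∃[ q ] q ∈ (x ∷ xs) × (∀ {z} → z ∈ (x ∷ xs) → f q ≤ f z)
  argmin f f-cong x [] = x , here refl , λ { (here z≈x) → f-cong (sym z≈x) }
  argmin f f-cong x (y ∷ ys) with q , q∈ , q-min ← argmin f f-cong y ys | total (f x) (f q)
  ... | inj₁ fx≤fq = x , here refl , λ
    { (here z≈x)  → f-cong (sym z≈x)
    ; (there z∈)  → ≤-trans fx≤fq (q-min z∈)
    }
  ... | inj₂ fq≤fx = q , there q∈ , λ
    { (here z≈x)  → ≤-trans fq≤fx (f-cong (sym z≈x))
    ; (there z∈)  → q-min z∈
    }

  optLength : ∀ xs → Small xs → ∃ (IsOptLength M xs)
  optLength []          (() , _)
  optLength xs@(x ∷ xs′) xs-small
    with q , q∈xs , q-min ← argmin (λ q → star q xs) (λ x≈y → ≤-reflexive (star-cong x≈y xs)) x xs′ =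
    star q xs , centred xs q∈xs xs-small , λ r (ys , ys↭xs , r≈) →
      let p , p∈xs , eq = ↭-path-star ys↭xs xs-small
      in ≤-trans (q-min p∈xs) (≤-reflexive (ℝ.sym (ℝ.trans r≈ eq)))

  pathLength-nonNeg : ∀ xs → 0# ≤ pathLength M xs
  pathLength-nonNeg []           = ≤-refl
  pathLength-nonNeg (x ∷ [])     = ≤-refl
  pathLength-nonNeg (x ∷ y ∷ xs) = 0≤+ nonNegative (pathLength-nonNeg (y ∷ xs))

  pathLength-pos : ∀ {xs} → Unique xs → 2 ℕ.≤ length xs → 0# < pathLength M xs
  pathLength-pos {[]} _ ()
  pathLength-pos {_ ∷ []} _ (s≤s ())
  pathLength-pos {x ∷ y ∷ xs} ((x≉y ∷ _) ∷ _) _ =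
    <-≤-trans (nonNegative , λ 0≈d → x≉y (0⇒≈ (ℝ.sym 0≈d))) (x≤x+nonNeg (pathLength-nonNeg (y ∷ xs)))

  optLength-pos : ∀ {xs o} → Unique xs → 2 ℕ.≤ length xs → IsOptLength M xs o → 0# < o
  optLength-pos xs-unique 2≤ ((ys , ys↭xs , o≈) , _) = <-≤-trans
    (pathLength-pos (Unique-resp-↭ (↭-sym ys↭xs) xs-unique)
      (≡.subst (2 ℕ.≤_) (≡.sym (xs↭ys⇒|xs|≡|ys| ys↭xs)) 2≤))
    (≤-reflexive (ℝ.sym o≈))

  -- Ratios and OR(2) for a fixed order.

  module Ratios (T : Order M) where
    open Order T
    private
      module T = IsTotalOrder isTotalOrder

    1≤ratio : ∀ {k q} → IsRatio M T k q → 1# ≤ q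
    1≤ratio (xs , xs-unique , 2≤ , _ , l , o , (ys , ys↭xs , _ , l≈) , o-opt , q≈) =
      ≤-trans (≤-trans (≤-reflexive (ℝ.sym (ℝ.*-inverseʳ o (0<⇒≉0 0<o)))) l/o) (≤-reflexive (ℝ.sym q≈))
      where
      0<o = optLength-pos xs-unique 2≤ o-opt
      l/o : o * o ⁻¹ ≤ l * o ⁻¹
      l/o = ≤-trans (≤-reflexive (ℝ.*-comm o (o ⁻¹)))
        (≤-trans (⁻¹-nonNeg 0<o ⊛ proj₂ o-opt l (ys , ys↭xs , l≈)) (≤-reflexive (ℝ.*-comm (o ⁻¹) l)))

    -- Inhabits the set of ratios, for the lower bound on OR and for completeness, which asks for a
    -- nonempty set.
    pair-ratio : ∀ {k x y} → 1 ℕ.≤ k → ¬ x ≈ y → ∃ (IsRatio M T k)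
    pair-ratio {k} {x} {y} 1≤k x≉y with T.total x y
    ... | inj₁ x≤y = _ , x ∷ y ∷ [] , (x≉y ∷ []) ∷ [] ∷ [] , s≤s (s≤s z≤n) , ℕ.+-monoˡ-≤ 1 1≤k , _ , _ ,
      (_ , ↭-refl , (x≤y , x≉y) ∷ [-] , ℝ.refl) ,
      proj₂ (optLength (x ∷ y ∷ []) (s≤s (s≤s z≤n) , s≤s (s≤s z≤n))) , ℝ.refl
    ... | inj₂ y≤x = _ , y ∷ x ∷ [] , (x≉y ∘ sym ∷ []) ∷ [] ∷ [] , s≤s (s≤s z≤n) , ℕ.+-monoˡ-≤ 1 1≤k , _ , _ ,
      (_ , ↭-refl , (y≤x , x≉y ∘ sym) ∷ [-] , ℝ.refl) ,
      proj₂ (optLength (y ∷ x ∷ []) (s≤s (s≤s z≤n) , s≤s (s≤s z≤n))) , ℝ.refl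

    1≤OR : ∀ {k r} → 1 ℕ.≤ k → IsOR M T k r → 1# ≤ r
    1≤OR {k} 1≤k (inj₁ ((_ , _ , x≉y) , r-sup)) with q , q-ratio ← pair-ratio {k} 1≤k x≉y =
      ≤-trans (1≤ratio {k} q-ratio) (proj₁ r-sup q q-ratio)
    1≤OR 1≤k (inj₂ (_ , r≈1)) = ≤-reflexive (ℝ.sym r≈1)

    fromℕ1 : ℝ.fromℕ 1 ℝ.≈ 1#
    fromℕ1 = ℝ.+-identityʳ 1#

    ¬breaking-1 : ¬ IsBreaking M T 1
    ¬breaking-1 (_ , r , r-OR , r<1) =
      ≤⇒≯ (≤-trans (≤-reflexive fromℕ1) (1≤OR {1} (s≤s z≤n) r-OR)) r<1

    <ₜ⇒≉ : ∀ {x y z} → x <ₜ y → y <ₜ z → ¬ x ≈ z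
    <ₜ⇒≉ (x≤y , x≉y) (y≤z , _) x≈z = x≉y (T.antisym x≤y (T.trans y≤z (T.reflexive (sym x≈z))))

    -- The competitor is the path `y, x, z` centred at `x`; its length bounds `l_opt` of the triple
    -- from above.
    triple-bound : ∀ {r x y z} → ℝ.IsUpperBound (IsRatio M T 2) r → x <ₜ y → y <ₜ z →
      d x y + d y z ≤ r * (d x y + d x z)
    triple-bound {r} {x} {y} {z} r-upper x<y y<z = begin
      d x y + d y z             ≈⟨ ℝ.+-congˡ (ℝ.+-identityʳ (d y z)) ⟨
      pathLength M xs           ≤⟨ ≤-*⁻¹ 0<o (r-upper _ ratio) ⟩
      r * o                     ≤⟨ 0≤r ⊛ proj₂ o-opt _ x-centred ⟩
      r * star x xs             ≈⟨ ℝ.*-congˡ (star-head x (y ∷ z ∷ [])) ⟩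
      r * (d x y + (d x z + 0#)) ≈⟨ ℝ.*-congˡ (ℝ.+-congˡ (ℝ.+-identityʳ (d x z))) ⟩
      r * (d x y + d x z)       ∎
      where
      open PosetReasoning poset
      xs = x ∷ y ∷ z ∷ []
      xs-small : Small xs
      xs-small = s≤s (s≤s z≤n) , ℕ.≤-refl
      xs-unique : Unique xs
      xs-unique = (proj₂ x<y ∷ <ₜ⇒≉ x<y y<z ∷ []) ∷ (proj₂ y<z ∷ []) ∷ [] ∷ []
      o = proj₁ (optLength xs xs-small)
      o-opt : IsOptLength M xs o
      o-opt = proj₂ (optLength xs xs-small)
      0<o : 0# < o
      0<o = optLength-pos xs-unique (proj₁ xs-small) o-opt
      ratio : IsRatio M T 2 (pathLength M xs * o ⁻¹)
      ratio = xs , xs-unique , proj₁ xs-small , proj₂ xs-small , _ , o ,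
        (xs , ↭-refl , x<y ∷ y<z ∷ [-] , ℝ.refl) , o-opt , ℝ.refl
      0≤r : 0# ≤ r
      0≤r = ≤-trans 0≤1 (≤-trans (1≤ratio {2} ratio) (r-upper _ ratio))
      x-centred : ∃[ ys ] ys ↭ xs × star x xs ℝ.≈ pathLength M ys
      x-centred = centred xs (here refl) xs-small

    module _ {μ} (0≤μ : 0# ≤ μ)
      (short : ∀ {x y z} → x <ₜ y → y <ₜ z → d x y ≤ μ * d x z × d y z ≤ μ * d x z) where

      private
        η : ℝ.Carrier
        η = (1# + μ) ⁻¹

        0<1+μ : 0# < 1# + μ
        0<1+μ = <-≤-trans 0<1 (x≤x+nonNeg 0≤μ)

        0≤η : 0# ≤ η
        0≤η = ⁻¹-nonNeg 0<1+μ

        [1+μ]η≈1 : (1# + μ) * η ℝ.≈ 1#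
        [1+μ]η≈1 = ℝ.*-inverseʳ (1# + μ) (0<⇒≉0 0<1+μ)

      -- Since `η` is the inverse of `1# + μ`, this is `2 - η`: one more than the largest share of
      -- `x` in `x + z` that `x ≤ μ * z` allows.
      ratioBound : ℝ.Carrier
      ratioBound = 1# + μ * η

      1≤ratioBound : 1# ≤ ratioBound
      1≤ratioBound = x≤x+nonNeg (ℝ.*-nonNeg 0≤μ 0≤η)

      ratioBound<2 : ratioBound < ℝ.fromℕ 2
      ratioBound<2 = by-adding 0≤η ratioBound+η≈2
        , λ eq → ≤⇒≯ (1≤0 (η≤0 eq)) 0<1
        where
        open SetoidReasoning ℝ.setoid
        ratioBound+η≈2 : ratioBound + η ℝ.≈ ℝ.fromℕ 2 + 0#
        ratioBound+η≈2 = begin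
          (1# + μ * η) + η   ≈⟨ solve 3 (λ m h u → (u :+ m :* h) :+ h := (u :+ (con 1 :+ m) :* h)) ℝ.refl μ η 1# ⟩
          1# + (1# + μ) * η  ≈⟨ ℝ.+-congˡ [1+μ]η≈1 ⟩
          1# + 1#            ≈⟨ solve 1 (λ u → u :+ u := (u :+ (u :+ con 0)) :+ con 0) ℝ.refl 1# ⟩
          ℝ.fromℕ 2 + 0#     ∎
        η≤0 : ratioBound ℝ.≈ ℝ.fromℕ 2 → η ≤ 0#
        η≤0 eq = by-adding (≤-reflexive (ℝ.sym eq))
          (ℝ.trans (ℝ.+-comm η ratioBound) (ℝ.trans ratioBound+η≈2 (ℝ.+-comm (ℝ.fromℕ 2) 0#)))
        1≤0 : η ≤ 0# → 1# ≤ 0#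
        1≤0 η≤0 = ≤-trans (≤-reflexive (ℝ.sym [1+μ]η≈1))
          (≤-trans (proj₁ 0<1+μ ⊛ η≤0) (≤-reflexive (ℝ.zeroʳ (1# + μ))))

      -- The sum `x + w` is at most `x + (x + z)`, and `x` is at most the fraction `μ * η` of
      -- `x + z`. The numbers stand for the leg between an outer centre and the middle point, the
      -- long side, and the other leg.
      worst-centre : ∀ {x z w} → x ≤ μ * z → w ≤ x + z → x + w ≤ ratioBound * (x + z)
      worst-centre {x} {z} {w} x≤μz w≤x+z = begin
        x + w                                  ≈⟨ ℝ.+-congʳ (ℝ.trans (ℝ.*-congʳ [1+μ]η≈1) (ℝ.*-identityˡ x)) ⟨
        ((1# + μ) * η) * x + w                 ≈⟨ solve 4 (λ m h x w → ((con 1 :+ m) :* h) :* x :+ w := (h :* x :+ w) :+ (m :* h) :* x) ℝ.refl μ η x w ⟩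
        (η * x + w) + (μ * η) * x              ≤⟨ ((0≤η ⊛ x≤μz) ⊕ w≤x+z) ⊕ ≤-refl ⟩
        (η * (μ * z) + (x + z)) + (μ * η) * x  ≈⟨ solve 4 (λ m h x z → (h :* (m :* z) :+ (x :+ z)) :+ (m :* h) :* x := (con 1 :+ m :* h) :* (x :+ z)) ℝ.refl μ η x z ⟩
        ratioBound * (x + z)                   ∎
        where open PosetReasoning poset

      ≤-ratioBound* : ∀ {x} → 0# ≤ x → x ≤ ratioBound * x
      ≤-ratioBound* {x} 0≤x = ≤-trans (≤-reflexive (ℝ.sym (ℝ.*-identityʳ x)))
        (≤-trans (0≤x ⊛ 1≤ratioBound) (≤-reflexive (ℝ.*-comm x ratioBound)))

      -- Only an outer centre of a triple gives a different length: the middle centre, or either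
      -- centre of a pair, returns that of the ordered path. The two outer cases are mirror images,
      -- so `short` has to bound both legs.
      star-bound : ∀ {q} xs → q ∈ xs → Linked _<ₜ_ xs → Small xs → pathLength M xs ≤ ratioBound * star q xs
      star-bound (x ∷ []) _ _ (s≤s () , _)
      star-bound xs@(x ∷ y ∷ []) (here q≈x) _ _ = ≤-trans (≤-ratioBound* (pathLength-nonNeg xs))
        (≤-reflexive (ℝ.*-congˡ (ℝ.sym (ℝ.trans (star-cong q≈x xs) (star-head x (y ∷ []))))))
      star-bound xs@(x ∷ y ∷ []) (there (here q≈y)) _ _ = ≤-trans (≤-ratioBound* (pathLength-nonNeg xs))
        (≤-reflexive (ℝ.*-congˡ (ℝ.trans (ℝ.+-cong (d-sym x y) (ℝ.sym (star-head y []))) (ℝ.sym (star-cong q≈y xs)))))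
      star-bound xs@(x ∷ y ∷ z ∷ []) (here q≈x) (x<y ∷ y<z ∷ [-]) _ = begin
        d x y + (d y z + 0#)                     ≈⟨ ℝ.+-congˡ (ℝ.+-identityʳ (d y z)) ⟩
        d x y + d y z                            ≤⟨ worst-centre (proj₁ (short x<y y<z))
                                                      (≤-trans (triangle y x z) (≤-reflexive (ℝ.+-congʳ (d-sym y x)))) ⟩
        ratioBound * (d x y + d x z)             ≈⟨ ℝ.*-congˡ (ℝ.+-congˡ (ℝ.+-identityʳ (d x z))) ⟨
        ratioBound * star x (y ∷ z ∷ [])         ≈⟨ ℝ.*-congˡ (ℝ.trans (star-cong q≈x xs) (star-head x (y ∷ z ∷ []))) ⟨
        ratioBound * star _ xs                   ∎
        where open PosetReasoning poset
      star-bound xs@(x ∷ y ∷ z ∷ []) (there (here q≈y)) _ _ = ≤-trans (≤-ratioBound* (pathLength-nonNeg xs))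
        (≤-reflexive (ℝ.*-congˡ (ℝ.trans (path₃ x y z) (ℝ.sym (star-cong q≈y xs)))))
      star-bound xs@(x ∷ y ∷ z ∷ []) (there (there (here q≈z))) (x<y ∷ y<z ∷ [-]) _ = begin
        d x y + (d y z + 0#)                     ≈⟨ solve 2 (λ x y → x :+ (y :+ con 0) := y :+ x) ℝ.refl (d x y) (d y z) ⟩
        d y z + d x y                            ≤⟨ worst-centre (proj₂ (short x<y y<z))
                                                      (≤-trans (triangle x z y) (≤-reflexive
                                                        (ℝ.trans (ℝ.+-comm (d x z) (d z y)) (ℝ.+-congʳ (d-sym z y))))) ⟩
        ratioBound * (d y z + d x z)             ≈⟨ ℝ.*-congˡ (ℝ.+-comm (d y z) (d x z)) ⟩
        ratioBound * (d x z + d y z)             ≈⟨ ℝ.*-congˡ (ℝ.+-cong (d-sym x z) (ℝ.trans (d-sym y z)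
                                                      (ℝ.trans (ℝ.sym (ℝ.+-identityʳ (d z y))) (ℝ.+-congˡ (ℝ.sym (star-head z [])))))) ⟩
        ratioBound * star z xs                   ≈⟨ ℝ.*-congˡ (star-cong q≈z xs) ⟨
        ratioBound * star _ xs                   ∎
        where open PosetReasoning poset
      star-bound (_ ∷ _ ∷ _ ∷ _ ∷ _) _ _ (_ , s≤s (s≤s (s≤s ())))

      ratio≤ratioBound : ℝ.IsUpperBound (IsRatio M T 2) ratioBound
      ratio≤ratioBound q (xs , xs-unique , 2≤ , ≤3 , l , o , (ys , ys↭xs , ys-sorted , l≈) , o-opt , q≈)
        with zs , zs↭xs , o≈ ← proj₁ o-opt
        with c , c∈ys , eq ← ↭-path-star (↭-trans zs↭xs (↭-sym ys↭xs)) (Small-↭ (↭-sym ys↭xs) (2≤ , ≤3)) =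
        ≤-trans (≤-reflexive q≈) (*⁻¹-≤ (optLength-pos xs-unique 2≤ o-opt)
          (≤-trans (≤-reflexive l≈) (≤-trans (star-bound ys c∈ys ys-sorted (Small-↭ (↭-sym ys↭xs) (2≤ , ≤3)))
            (≤-reflexive (ℝ.*-congˡ (ℝ.sym (ℝ.trans o≈ eq)))))))

    -- Inserting `d x y - d x z ≤ d y z` into `triple-bound` gives
    -- `(2 - r) * d x y ≤ (1 + r) * d x z`; the gap `2 - r` is positive and can be divided out.
    breaking-2⇒convex : (∀ {a} → ExcludedMiddle a) → IsBreaking M T 2 →
      ∃[ λ₀ ] 0# ≤ λ₀ × (∀ {x y z} → x ≤ₜ y → y ≤ₜ z → d x y ≤ λ₀ * d x z)
    breaking-2⇒convex em (_ , r , r-OR , r≤2 , r≉2) = λ₀ , 0≤+ 0≤s⁻¹[1+r] 0≤1 , convex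
      where
      s = ℝ.fromℕ 2 - r

      0<s : 0# < s
      0<s = ≤⇒0≤- r≤2 , λ 0≈s →
        r≉2 (ℝ.trans (ℝ.trans (ℝ.sym (ℝ.+-identityˡ r)) (ℝ.+-congʳ 0≈s)) (sub-add (ℝ.fromℕ 2) r))

      0≤s⁻¹[1+r] : 0# ≤ s ⁻¹ * (1# + r)
      0≤s⁻¹[1+r] = ℝ.*-nonNeg (⁻¹-nonNeg 0<s) (0≤+ 0≤1 (≤-trans 0≤1 (1≤OR {2} (s≤s z≤n) r-OR)))

      -- The summand `1#` covers `y ≈ z`: the triple degenerates, and `d x y` equals `d x z`.
      λ₀ = s ⁻¹ * (1# + r) + 1#

      bound : IsOR M T 2 r → ∀ {x y z} → x <ₜ y → y <ₜ z → d x y + d y z ≤ r * (d x y + d x z)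
      bound (inj₁ (_ , r-sup)) x<y y<z = triple-bound (proj₁ r-sup) x<y y<z
      bound (inj₂ ((_ , single) , _)) {x} {y} (_ , x≉y) _ =
        ⊥-elim (x≉y (Setoid.trans setoid (sym (single x)) (single y)))

      s*dxy≤ : ∀ {x y z} → x <ₜ y → y <ₜ z → s * d x y ≤ (1# + r) * d x z
      s*dxy≤ {x} {y} {z} x<y y<z = by-adding
        (bound r-OR x<y y<z ⊕ ≤-trans (triangle x z y) (≤-refl ⊕ ≤-reflexive (d-sym z y)) ⊕
          ≤-reflexive (ℝ.*-congʳ (sub-add (ℝ.fromℕ 2) r)))
        (solve 5 (λ s r a b c →
            s :* a :+ (r :* (a :+ c) :+ ((c :+ b) :+ (con 1 :+ (con 1 :+ con 0)) :* a)) :=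
            (con 1 :+ r) :* c :+ ((a :+ b) :+ (a :+ (s :+ r) :* a)))
          ℝ.refl s r (d x y) (d y z) (d x z))

      convex : ∀ {x y z} → x ≤ₜ y → y ≤ₜ z → d x y ≤ λ₀ * d x z
      convex {x} {y} {z} x≤y y≤z with em {P = x ≈ y} | em {P = y ≈ z}
      ... | yes x≈y | _ = ≤-trans (≤-reflexive (≈⇒0 x≈y)) (ℝ.*-nonNeg (0≤+ 0≤s⁻¹[1+r] 0≤1) nonNegative)
      ... | no _ | yes y≈z = by-adding (≤-reflexive (d-cong refl y≈z) ⊕ ℝ.*-nonNeg 0≤s⁻¹[1+r] (nonNegative {x} {z}))
        (solve 3 (λ a c k → a :+ (c :+ k :* c) := (k :+ con 1) :* c :+ (a :+ con 0))
          ℝ.refl (d x y) (d x z) (s ⁻¹ * (1# + r)))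
      ... | no x≉y | no y≉z = begin
        d x y                          ≤⟨ ≤-⁻¹* 0<s (s*dxy≤ (x≤y , x≉y) (y≤z , y≉z)) ⟩
        s ⁻¹ * ((1# + r) * d x z)      ≈⟨ ℝ.*-assoc (s ⁻¹) (1# + r) (d x z) ⟨
        (s ⁻¹ * (1# + r)) * d x z      ≤⟨ x≤x+nonNeg (ℝ.*-nonNeg 0≤1 nonNegative) ⟩
        (s ⁻¹ * (1# + r)) * d x z + 1# * d x z ≈⟨ ℝ.distribʳ (d x z) (s ⁻¹ * (1# + r)) 1# ⟨
        λ₀ * d x z                     ∎
        where open PosetReasoning poset

-- From convexity of the order to coarse betweenness along geodesics.

module CoarselyOrdered
  (em : ∀ {a} → ExcludedMiddle a) {ℓ} {R : CompleteOrderedField ℓ}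
  (M : MetricSpace R) (T : Order M) (G : MetricSpace R) (geodesic : IsGeodesic {R = R} G)
  (M∼G : QuasiIsometric M G) where

  private
    module ℝ = CompleteOrderedField R
    module G where
      open MetricSpace G public
      open IsGeneralMetric isMetric public
        using (nonNegative; triangle; ≈⇒0)
        renaming (cong to d-cong; sym to d-sym)
      open Setoid setoid public using (refl)
    module T = IsTotalOrder (Order.isTotalOrder T)
  open CompleteOrderedField R using (0#; 1#; _+_; _*_; _-_; -_; _≤_; _<_; _⁻¹)
  open OrderedField R
  open MetricSpace M
  open Setoid setoid using (refl)
  open Order T using (_≤ₜ_)

  D : ℝ.Carrier
  D = proj₁ (proj₂ (proj₂ M∼G))

  private
    α : setoid ⟶ₛ G.setoid
    α = proj₁ M∼G
    C₁ C₂ : ℝ.Carrier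
    C₁ = proj₁ (proj₁ (proj₂ M∼G))
    C₂ = proj₁ (proj₂ (proj₁ (proj₂ M∼G)))

    1≤C₁ : 1# ≤ C₁
    1≤C₁ = proj₁ (proj₂ (proj₂ (proj₁ (proj₂ M∼G))))

    0≤C₂ : 0# ≤ C₂
    0≤C₂ = proj₁ (proj₂ (proj₂ (proj₂ (proj₁ (proj₂ M∼G)))))

    distortion : ∀ x y → C₁ ⁻¹ * d x y - C₂ ≤ G.d (α ⟨$⟩ x) (α ⟨$⟩ y) ×
      G.d (α ⟨$⟩ x) (α ⟨$⟩ y) ≤ C₁ * d x y + C₂
    distortion = proj₂ (proj₂ (proj₂ (proj₂ (proj₁ (proj₂ M∼G)))))

    dense : ∀ g → ∃[ x ] G.d g (α ⟨$⟩ x) ≤ D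
    dense = proj₂ (proj₂ (proj₂ M∼G))

    0<C₁ : 0# < C₁
    0<C₁ = <-≤-trans 0<1 1≤C₁

  p : Carrier → Carrier → ℝ.Carrier
  p x y = G.d (α ⟨$⟩ x) (α ⟨$⟩ y)

  p-cong : ∀ {x y u v} → x ≈ y → u ≈ v → p x u ℝ.≈ p y v
  p-cong x≈y u≈v = G.d-cong (Func.cong α x≈y) (Func.cong α u≈v)

  p-nonNeg : ∀ {x y} → 0# ≤ p x y
  p-nonNeg = G.nonNegative

  p-sym : ∀ x y → p x y ≤ p y x
  p-sym x y = ≤-reflexive (G.d-sym (α ⟨$⟩ x) (α ⟨$⟩ y))

  p-triangle : ∀ x y z → p x z ≤ p x y + p y z
  p-triangle x y z = G.triangle (α ⟨$⟩ x) (α ⟨$⟩ y) (α ⟨$⟩ z)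

  d≤p : ∀ x y → d x y ≤ C₁ * (p x y + C₂)
  d≤p x y = ⁻¹*-≤ 0<C₁ (-≤⇒≤-+ (proj₁ (distortion x y)))

  0≤D : Carrier → 0# ≤ D
  0≤D x = ≤-trans G.nonNegative (proj₂ (dense (α ⟨$⟩ x)))

  p-bounded⇒bounded : ∀ {B} → (∀ x y → p x y ≤ B) → IsBounded M
  p-bounded⇒bounded {B} p≤B = C₁ * (B + C₂) , λ x y →
    ≤-trans (d≤p x y) (proj₁ 0<C₁ ⊛ (p≤B x y ⊕ ≤-refl))

  -- Passing from `d` to `p` already costs `C₁` and `C₂`; a map that keeps `p` up to the additive
  -- error `F` retains `C₁` and only enlarges `C₂` by `F`.
  quasiIsometric : ∀ (N : MetricSpace R) (f : setoid ⟶ₛ MetricSpace.setoid N) {F D′} → 0# ≤ F →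
    (∀ x y → MetricSpace.d N (f ⟨$⟩ x) (f ⟨$⟩ y) ≤ p x y + F) →
    (∀ x y → p x y ≤ MetricSpace.d N (f ⟨$⟩ x) (f ⟨$⟩ y) + F) →
    (∀ n → ∃[ x ] MetricSpace.d N n (f ⟨$⟩ x) ≤ D′) →
    QuasiIsometric M N
  quasiIsometric N f {F} {D′} 0≤F upper lower f-dense =
    f , (C₁ , C₂ + F , 1≤C₁ , 0≤+ 0≤C₂ 0≤F , λ x y →
      ≤-+⇒-≤ (≤-trans (-≤⇒≤-+ (proj₁ (distortion x y))) (≤-trans (lower x y ⊕ ≤-refl)
        (≤-reflexive (solve 3 (λ q F C → (q :+ F) :+ C := q :+ (C :+ F)) ℝ.refl
          (MetricSpace.d N (f ⟨$⟩ x) (f ⟨$⟩ y)) F C₂)))) ,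
      ≤-trans (upper x y) (≤-trans (proj₂ (distortion x y) ⊕ ≤-refl)
        (≤-reflexive (ℝ.+-assoc (C₁ * d x y) C₂ F)))) ,
    D′ , f-dense

  dist-≤-sub : ∀ {s t} → s ≤ t → dist R s t + s ≤ t
  dist-≤-sub {s} {t} s≤t = ≤-trans (dist-≤ s≤t-s+t (≤-reflexive (ℝ.sym (sub-add t s))) ⊕ ≤-refl)
    (≤-reflexive (sub-add t s))
    where
    s≤t-s+t : s ≤ t - s + t
    s≤t-s+t = ≤-trans s≤t (≤-trans (x≤x+nonNeg (≤⇒0≤- s≤t)) (≤-reflexive (ℝ.+-comm t (t - s))))

  module Geodesic (x y : Carrier) where
    γ = proj₁ (geodesic (α ⟨$⟩ x) (α ⟨$⟩ y))
    γ-start = proj₁ (proj₂ (proj₂ (geodesic (α ⟨$⟩ x) (α ⟨$⟩ y))))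
    γ-end = proj₂ (proj₂ (proj₂ (geodesic (α ⟨$⟩ x) (α ⟨$⟩ y))))

    Time : Set ℓ
    Time = ∃[ t ] 0# ≤ t × t ≤ p x y

    start : Time
    start = 0# , ≤-refl , G.nonNegative

    end : Time
    end = p x y , G.nonNegative , ≤-refl

    from-time : ∀ (s t : Time) → proj₁ s ≤ proj₁ t →
      G.d (γ ⟨$⟩ s) (γ ⟨$⟩ t) + proj₁ s ≤ proj₁ t
    from-time s t s≤t = ≤-trans
      (≤-reflexive (proj₁ (proj₂ (geodesic (α ⟨$⟩ x) (α ⟨$⟩ y))) s t) ⊕ ≤-refl) (dist-≤-sub s≤t)

    from-start : ∀ t → G.d (α ⟨$⟩ x) (γ ⟨$⟩ t) ≤ proj₁ t
    from-start t = ≤-trans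
      (≤-reflexive (ℝ.trans (G.d-cong (Setoid.sym G.setoid (γ-start start ℝ.refl)) G.refl)
        (ℝ.sym (ℝ.+-identityʳ _))))
      (from-time start t (proj₁ (proj₂ t)))

    to-end : ∀ t → G.d (γ ⟨$⟩ t) (α ⟨$⟩ y) + proj₁ t ≤ p x y
    to-end t = ≤-trans
      (≤-reflexive (G.d-cong G.refl (Setoid.sym G.setoid (γ-end end ℝ.refl))) ⊕ ≤-refl)
      (from-time t end (proj₂ (proj₂ t)))

    -- Density replaces the geodesic's point at time `t` by a point of `M` at cost `D`. The last
    -- estimate records progress towards `y`; it later exposes a point lying on the wrong side of
    -- the base point.
    interpolate : ∀ (t : Time) →
      ∃[ z ] p x z ≤ proj₁ t + D × proj₁ t ≤ p x z + D × p z y + proj₁ t ≤ p x y + D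
    interpolate t@(t₀ , _) with z , near ← dense (γ ⟨$⟩ t) = z ,
      ≤-trans (G.triangle (α ⟨$⟩ x) (γ ⟨$⟩ t) (α ⟨$⟩ z)) (from-start t ⊕ near) ,
      by-adding (p-triangle x z y ⊕ remaining z near)
        (solve 5 (λ t q l r D → t :+ ((q :+ r) :+ (l :+ D)) := (q :+ D) :+ (l :+ (r :+ t)))
          ℝ.refl t₀ (p x z) (p x y) (p z y) D) ,
      remaining z near
      where
      remaining : ∀ z → G.d (γ ⟨$⟩ t) (α ⟨$⟩ z) ≤ D → p z y + t₀ ≤ p x y + D
      remaining z near = by-adding
        (G.triangle (α ⟨$⟩ z) (γ ⟨$⟩ t) (α ⟨$⟩ y) ⊕
          ≤-trans (≤-reflexive (G.d-sym (α ⟨$⟩ z) (γ ⟨$⟩ t))) near ⊕ to-end t)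
        (solve 6 (λ r t l D n b → (r :+ t) :+ ((n :+ b) :+ (D :+ l)) := (l :+ D) :+ (r :+ (n :+ (b :+ t))))
          ℝ.refl (p z y) t₀ (p x y) D (G.d (α ⟨$⟩ z) (γ ⟨$⟩ t)) (G.d (γ ⟨$⟩ t) (α ⟨$⟩ y)))

  module _ (λ₀ : ℝ.Carrier) (0≤λ₀ : 0# ≤ λ₀)
    (convex : ∀ {x y z} → x ≤ₜ y → y ≤ₜ z → d x y ≤ λ₀ * d x z) where

    private
      W V : ℝ.Carrier
      -- `W` bounds `p` between points of `M` within `D` of geodesic points whose times differ by at
      -- most 2. `V` is the result of carrying `W` over to `d`, applying `convex` there, and
      -- carrying the outcome back to `p`.
      W = (D + D) + (1# + 1#)
      V = C₁ * (λ₀ * (C₁ * (W + C₂))) + C₂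

    near-of-jump : ∀ {x y z} → x ≤ₜ y → y ≤ₜ z → p x z ≤ W → p x y ≤ V
    near-of-jump {x} {y} {z} x≤y y≤z pxz≤W = ≤-trans (proj₂ (distortion x y))
      ((proj₁ 0<C₁ ⊛ ≤-trans (convex x≤y y≤z)
        (0≤λ₀ ⊛ ≤-trans (d≤p x z) (proj₁ 0<C₁ ⊛ (pxz≤W ⊕ ≤-refl)))) ⊕ ≤-refl)

    -- A geodesic from x to z starts near points of M below y and ends near
    -- points above y, so at the supremum of the times at which it is near
    -- a point below y it jumps over y.
    geodesic-near : ∀ {x y z} → x ≤ₜ y → y ≤ₜ z →
      ∃[ t ] G.d (Geodesic.γ x z ⟨$⟩ t) (α ⟨$⟩ y) ≤ D + V
    geodesic-near {x} {y} {z} x≤y y≤z = t , ≤-trans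
      (G.triangle (γ ⟨$⟩ t) (α ⟨$⟩ below) (α ⟨$⟩ y)) (t-near-below ⊕ jump)
      where
      open Geodesic x z

      NearBelow : ℝ.Carrier → Set ℓ
      NearBelow t = ∃[ bounds ] ∃[ v ] v ≤ₜ y × G.d (γ ⟨$⟩ (t , bounds)) (α ⟨$⟩ v) ≤ D

      start-near : NearBelow 0#
      start-near = proj₂ start , x , x≤y ,
        ≤-trans (≤-reflexive (G.≈⇒0 (γ-start start ℝ.refl))) (0≤D x)

      last : ∃ (ℝ.IsSupremum NearBelow)
      last = ℝ.complete NearBelow (0# , start-near) (p x z , λ _ near → proj₂ (proj₁ near))

      -- The supremum need not be attained. A time within 1 of it will do: adding 2 then overshoots
      -- the supremum by at least 1.
      almost-last : ∃[ t ] NearBelow t × proj₁ last ≤ t + 1#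
      almost-last = supremum-approached em (proj₂ last) 0<1

      t₀ = proj₁ almost-last
      t : Time
      t = t₀ , proj₁ (proj₁ (proj₂ almost-last))
      below = proj₁ (proj₂ (proj₁ (proj₂ almost-last)))
      below≤y : below ≤ₜ y
      below≤y = proj₁ (proj₂ (proj₂ (proj₁ (proj₂ almost-last))))
      t-near-below : G.d (γ ⟨$⟩ t) (α ⟨$⟩ below) ≤ D
      t-near-below = proj₂ (proj₂ (proj₂ (proj₁ (proj₂ almost-last))))

      t₀≤t₀+2 : t₀ ≤ t₀ + (1# + 1#)
      t₀≤t₀+2 = x≤x+nonNeg (0≤+ 0≤1 0≤1)

      later-not-near : ¬ NearBelow (t₀ + (1# + 1#))
      later-not-near near = ≤⇒≯ 1≤0 0<1
        where
        1≤0 : 1# ≤ 0#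
        1≤0 = by-adding (≤-trans (proj₁ (proj₂ last) _ near) (proj₂ (proj₂ almost-last)))
          (solve 2 (λ t u → u :+ (t :+ u) := con 0 :+ (t :+ (u :+ u))) ℝ.refl t₀ 1#)

      reach : ∀ {v} (s : Time) → t₀ ≤ proj₁ s → proj₁ s ≤ t₀ + (1# + 1#) →
        G.d (γ ⟨$⟩ s) (α ⟨$⟩ v) ≤ D → p below v ≤ W
      reach {v} s t≤s s≤t+2 s-near = by-adding
        (G.triangle (α ⟨$⟩ below) (γ ⟨$⟩ t) (α ⟨$⟩ v) ⊕
          ≤-trans (≤-reflexive (G.d-sym (α ⟨$⟩ below) (γ ⟨$⟩ t))) t-near-below ⊕
          ≤-trans (G.triangle (γ ⟨$⟩ t) (γ ⟨$⟩ s) (α ⟨$⟩ v)) (≤-refl ⊕ s-near) ⊕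
          from-time t s t≤s ⊕ s≤t+2)
        (solve 8 (λ P a b c D t s u →
            P :+ ((a :+ b) :+ (D :+ ((c :+ D) :+ (s :+ (t :+ u))))) :=
            ((D :+ D) :+ u) :+ (P :+ (a :+ (b :+ ((c :+ t) :+ s)))))
          ℝ.refl (p below v) (G.d (α ⟨$⟩ below) (γ ⟨$⟩ t)) (G.d (γ ⟨$⟩ t) (α ⟨$⟩ v))
            (G.d (γ ⟨$⟩ t) (γ ⟨$⟩ s)) D t₀ (proj₁ s) (1# + 1#))

      jump : p below y ≤ V
      jump with total (t₀ + (1# + 1#)) (p x z)
      -- The geodesic ends before time `t₀ + 2`, and its endpoint `z`, which lies above `y`, serves
      -- as the far side of the jump.
      ... | inj₂ end≤t+2 = near-of-jump below≤y y≤z (reach end (proj₂ (proj₂ t)) end≤t+2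
        (≤-trans (≤-reflexive (G.≈⇒0 (γ-end end ℝ.refl))) (0≤D x)))
      ... | inj₁ t+2≤end with dense (γ ⟨$⟩ s)
        where
        s : Time
        s = t₀ + (1# + 1#) , ≤-trans (proj₁ (proj₂ t)) t₀≤t₀+2 , t+2≤end
      ...   | v , s-near with T.total v y
      ...     | inj₁ v≤y = ⊥-elim (later-not-near (_ , v , v≤y , s-near))
      ...     | inj₂ y≤v = near-of-jump below≤y y≤v (reach _ t₀≤t₀+2 ≤-refl s-near)

    -- Both legs are routed through the geodesic's point near `y`. The two geodesic pieces add up to
    -- `p x z`, and the detour to `y` is paid twice.
    coarselyBetween : ∃[ E ] ∀ {x y z} → x ≤ₜ y → y ≤ₜ z → p x y + p y z ≤ p x z + E
    coarselyBetween = (D + V) + (D + V) , bound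
      where
      bound : ∀ {x y z} → x ≤ₜ y → y ≤ₜ z → p x y + p y z ≤ p x z + ((D + V) + (D + V))
      bound {x} {y} {z} x≤y y≤z with t , near ← geodesic-near x≤y y≤z = by-adding
        (G.triangle (α ⟨$⟩ x) (γ ⟨$⟩ t) (α ⟨$⟩ y) ⊕ G.triangle (α ⟨$⟩ y) (γ ⟨$⟩ t) (α ⟨$⟩ z) ⊕
          from-start t ⊕ to-end t ⊕ near ⊕ ≤-trans (≤-reflexive (G.d-sym (α ⟨$⟩ y) (γ ⟨$⟩ t))) near)
        (solve 9 (λ P Q a b c e N t l →
            (P :+ Q) :+ ((a :+ b) :+ ((c :+ e) :+ (t :+ (l :+ (N :+ N))))) :=
            (l :+ (N :+ N)) :+ (P :+ (Q :+ (a :+ ((e :+ t) :+ (b :+ c))))))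
          ℝ.refl (p x y) (p y z) (G.d (α ⟨$⟩ x) (γ ⟨$⟩ t)) (G.d (γ ⟨$⟩ t) (α ⟨$⟩ y))
            (G.d (α ⟨$⟩ y) (γ ⟨$⟩ t)) (G.d (γ ⟨$⟩ t) (α ⟨$⟩ z)) (D + V) (proj₁ t) (p x z))
        where open Geodesic x z

  -- Signed distance to a base point as a coarse coordinate.

  module Coordinate (o : Carrier) (E : ℝ.Carrier)
    (between : ∀ {x y z} → x ≤ₜ y → y ≤ₜ z → p x y + p y z ≤ p x z + E) where

    private
      module Line = IsGeneralMetric (MetricSpace.isMetric (Line R))

    radius : Carrier → ℝ.Carrier
    radius x = p o x

    0≤E : 0# ≤ E
    0≤E = ≤-trans p-nonNeg
      (by-adding (between (T.refl {o}) (T.refl {o}))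
        (solve 2 (λ q e → q :+ (q :+ e) := e :+ (q :+ q)) ℝ.refl (p o o) E))

    radius-1-Lipschitz : ∀ x y → dist R (radius x) (radius y) ≤ p x y
    radius-1-Lipschitz x y = dist-≤
      (≤-trans (p-triangle o y x) (≤-trans (≤-refl ⊕ p-sym y x) (≤-reflexive (ℝ.+-comm (p o y) (p x y)))))
      (≤-trans (p-triangle o x y) (≤-reflexive (ℝ.+-comm (p o x) (p x y))))

    p≤radius+radius : ∀ x y → p x y ≤ radius x + radius y
    p≤radius+radius x y = ≤-trans (p-triangle x o y) (p-sym x o ⊕ ≤-refl)

    opposite-sides : ∀ {x y} → x ≤ₜ o → o ≤ₜ y → radius x + radius y ≤ p x y + E
    opposite-sides {x} x≤o o≤y = ≤-trans (p-sym o x ⊕ ≤-refl) (between x≤o o≤y)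

    SameSide : Carrier → Carrier → Set ℓ
    SameSide x y = (o ≤ₜ x × o ≤ₜ y) ⊎ (x ≤ₜ o × y ≤ₜ o)

    -- Of two points on one side of `o`, one lies between `o` and the other, so betweenness makes
    -- `p x y` the difference of the radii up to `E`.
    same-side : ∀ {x y} → SameSide x y → p x y ≤ dist R (radius x) (radius y) + E
    same-side {x} {y} side with x≤y⊎y≤x side
      where
      x≤y⊎y≤x : SameSide x y → (radius x + p x y ≤ radius y + E) ⊎ (radius y + p x y ≤ radius x + E)
      x≤y⊎y≤x side with T.total x y | side
      ... | inj₁ x≤y | inj₁ (o≤x , _) = inj₁ (between o≤x x≤y)
      ... | inj₂ y≤x | inj₁ (_ , o≤y) = inj₂ (≤-trans (≤-refl ⊕ p-sym x y) (between o≤y y≤x))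
      ... | inj₁ x≤y | inj₂ (_ , y≤o) = inj₂ (≤-trans
        (≤-trans (≤-reflexive (ℝ.+-comm (radius y) (p x y))) (≤-refl ⊕ p-sym o y))
        (≤-trans (between x≤y y≤o) (p-sym x o ⊕ ≤-refl)))
      ... | inj₂ y≤x | inj₂ (x≤o , _) = inj₁ (≤-trans
        (≤-trans (≤-reflexive (ℝ.+-comm (radius x) (p x y))) (p-sym x y ⊕ p-sym o x))
        (≤-trans (between y≤x x≤o) (p-sym y o ⊕ ≤-refl)))
    ... | inj₁ h = by-adding (h ⊕ ≤-distʳ (radius x) (radius y))
      (solve 5 (λ P a b δ e → P :+ ((b :+ e) :+ (δ :+ a)) := (δ :+ e) :+ ((a :+ P) :+ b))
        ℝ.refl (p x y) (radius x) (radius y) (dist R (radius x) (radius y)) E)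
    ... | inj₂ h = by-adding (h ⊕ ≤-distˡ (radius x) (radius y))
      (solve 5 (λ P a b δ e → P :+ ((a :+ e) :+ (δ :+ b)) := (δ :+ e) :+ ((b :+ P) :+ a))
        ℝ.refl (p x y) (radius x) (radius y) (dist R (radius x) (radius y)) E)

    point-at-radius : ∀ {t y} → 0# ≤ t → t ≤ radius y →
      ∃[ x ] radius x ≤ t + D × t ≤ radius x + D × p x y + t ≤ radius y + D
    point-at-radius {t} {y} 0≤t t≤r = Geodesic.interpolate o y (t , 0≤t , t≤r)

    -- The unsigned radius is the coordinate: a side of radius at most `B` can be folded onto the
    -- other. The hypothesis on straddling pairs covers both choices of the short side.
    quasiIsometric-ray : ∀ {B} → (∀ {x y} → x ≤ₜ o → o ≤ₜ y → radius x ≤ B ⊎ radius y ≤ B) →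
      (∀ t → ∃[ y ] t ≤ radius y) → QuasiIsometric M (Ray R)
    quasiIsometric-ray {B} bounded-side unbounded =
      quasiIsometric (Ray R) f {E + (B + B)} {D} (0≤+ 0≤E (0≤+ 0≤B 0≤B))
        (λ x y → ≤-trans (radius-1-Lipschitz x y) (x≤x+nonNeg (0≤+ 0≤E (0≤+ 0≤B 0≤B))))
        lower f-dense
      where
      f : setoid ⟶ₛ MetricSpace.setoid (Ray R)
      f = record { to = λ x → radius x , p-nonNeg ; cong = p-cong refl }

      0≤B : 0# ≤ B
      0≤B with bounded-side (T.refl {o}) (T.refl {o})
      ... | inj₁ r≤B = ≤-trans p-nonNeg r≤B
      ... | inj₂ r≤B = ≤-trans p-nonNeg r≤B

      δ : Carrier → Carrier → ℝ.Carrier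
      δ x y = dist R (radius x) (radius y)

      -- The sum of two radii exceeds their distance by twice the smaller one, hence the error
      -- `B + B`.
      opposite : ∀ x y → radius x ≤ B ⊎ radius y ≤ B → p x y ≤ δ x y + (E + (B + B))
      opposite x y (inj₁ r≤B) = by-adding
        (p≤radius+radius x y ⊕ ≤-distʳ (radius x) (radius y) ⊕ (r≤B ⊕ r≤B) ⊕ 0≤E)
        (solve 6 (λ P a b δ e B → P :+ ((a :+ b) :+ ((δ :+ a) :+ ((B :+ B) :+ e))) :=
            (δ :+ (e :+ (B :+ B))) :+ (P :+ (b :+ ((a :+ a) :+ con 0))))
          ℝ.refl (p x y) (radius x) (radius y) (δ x y) E B)
      opposite x y (inj₂ r≤B) = by-adding
        (p≤radius+radius x y ⊕ ≤-distˡ (radius x) (radius y) ⊕ (r≤B ⊕ r≤B) ⊕ 0≤E)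
        (solve 6 (λ P a b δ e B → P :+ ((a :+ b) :+ ((δ :+ b) :+ ((B :+ B) :+ e))) :=
            (δ :+ (e :+ (B :+ B))) :+ (P :+ (a :+ ((b :+ b) :+ con 0))))
          ℝ.refl (p x y) (radius x) (radius y) (δ x y) E B)

      same : ∀ {x y} → SameSide x y → p x y ≤ δ x y + (E + (B + B))
      same side = ≤-trans (same-side side) (≤-refl ⊕ x≤x+nonNeg (0≤+ 0≤B 0≤B))

      lower : ∀ x y → p x y ≤ δ x y + (E + (B + B))
      lower x y with T.total o x | T.total o y
      ... | inj₁ o≤x | inj₁ o≤y = same (inj₁ (o≤x , o≤y))
      ... | inj₂ x≤o | inj₂ y≤o = same (inj₂ (x≤o , y≤o))
      ... | inj₂ x≤o | inj₁ o≤y = opposite x y (bounded-side x≤o o≤y)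
      ... | inj₁ o≤x | inj₂ y≤o = opposite x y (Sum.swap (bounded-side y≤o o≤x))

      f-dense : ∀ n → ∃[ x ] dist R (proj₁ n) (radius x) ≤ D
      f-dense (t , 0≤t) with y , t≤r ← unbounded t
        with x , r≤t+D , t≤r+D , _ ← point-at-radius 0≤t t≤r = x , dist-≤
          (≤-trans t≤r+D (≤-reflexive (ℝ.+-comm (radius x) D)))
          (≤-trans r≤t+D (≤-reflexive (ℝ.+-comm t D)))

    signed : Carrier → ℝ.Carrier
    signed x with em {P = o ≤ₜ x}
    ... | yes _ = radius x
    ... | no  _ = - radius x

    -- The value is described by sums, without negation, so that the estimates are semiring
    -- identities for `by-adding`. The clause `x ≤ₜ o` is the form that betweenness consumes.
    Signed : Carrier → ℝ.Carrier → Set ℓ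
    Signed x a = (o ≤ₜ x × a ℝ.≈ radius x) ⊎ (x ≤ₜ o × a + radius x ℝ.≈ 0#)

    signed-Signed : ∀ x → Signed x (signed x)
    signed-Signed x with em {P = o ≤ₜ x} | T.total o x
    ... | yes o≤x | _        = inj₁ (o≤x , ℝ.refl)
    ... | no  o≰x | inj₁ o≤x = ⊥-elim (o≰x o≤x)
    ... | no  _   | inj₂ x≤o = inj₂ (x≤o , ℝ.-‿inverseˡ (radius x))

    signed-cong : ∀ {x y} → x ≈ y → signed x ℝ.≈ signed y
    signed-cong {x} {y} x≈y with em {P = o ≤ₜ x} | em {P = o ≤ₜ y}
    ... | yes _   | yes _   = p-cong refl x≈y
    ... | no  _   | no  _   = ℝ.-‿cong (p-cong refl x≈y)
    ... | yes o≤x | no  o≰y = ⊥-elim (o≰y (T.trans o≤x (T.reflexive x≈y)))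
    ... | no  o≰x | yes o≤y = ⊥-elim (o≰x (T.trans o≤y (T.reflexive (Setoid.sym setoid x≈y))))

    dist-neg : ∀ {a b u v} → a + u ℝ.≈ 0# → b + v ℝ.≈ 0# → dist R u v ≤ dist R a b
    dist-neg {a} {b} {u} {v} a+u≈0 b+v≈0 = dist-≤
      (by-adding (≤-distʳ a b ⊕ ≤-reflexive (ℝ.trans a+u≈0 (ℝ.sym b+v≈0)))
        (solve 5 (λ a b u v δ → u :+ ((δ :+ a) :+ (b :+ v)) := (δ :+ v) :+ (b :+ (a :+ u)))
          ℝ.refl a b u v (dist R a b)))
      (by-adding (≤-distˡ a b ⊕ ≤-reflexive (ℝ.trans b+v≈0 (ℝ.sym a+u≈0)))
        (solve 5 (λ a b u v δ → v :+ ((δ :+ b) :+ (a :+ u)) := (δ :+ u) :+ (a :+ (b :+ v)))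
          ℝ.refl a b u v (dist R a b)))

    negate : ∀ {a u} → a + u ℝ.≈ 0# → u + a ℝ.≈ 0#
    negate {a} {u} = ℝ.trans (ℝ.+-comm u a)

    0≤radius : ∀ x → 0# ≤ radius x
    0≤radius x = p-nonNeg

    -- Across `o` the difference `a - b` is the sum of the radii, so `opposite-sides` applies; the
    -- other half of `dist-≤` holds because `b ≤ 0# ≤ a`.
    mixed-upper : ∀ {x y a b} → o ≤ₜ x → a ℝ.≈ radius x → y ≤ₜ o → b + radius y ℝ.≈ 0# →
      dist R a b ≤ p x y + E
    mixed-upper {x} {y} {a} {b} o≤x a≈ y≤o b+r≈0 = dist-≤
      (by-adding (opposite-sides y≤o o≤x ⊕ p-sym y x ⊕ ≤-reflexive a≈ ⊕ ≤-reflexive (ℝ.sym b+r≈0))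
        (solve 7 (λ a b r s P Q e → a :+ ((Q :+ e) :+ (P :+ (r :+ (b :+ s)))) :=
            ((P :+ e) :+ b) :+ ((s :+ r) :+ (Q :+ (a :+ con 0))))
          ℝ.refl a b (radius x) (radius y) (p x y) (p y x) E))
      (by-adding (≤-reflexive b+r≈0 ⊕ 0≤radius y ⊕ 0≤+ (0≤+ (p-nonNeg {x} {y}) 0≤E)
          (≤-trans (0≤radius x) (≤-reflexive (ℝ.sym a≈))))
        (solve 5 (λ a b s P e → b :+ (con 0 :+ (s :+ ((P :+ e) :+ a))) :=
            ((P :+ e) :+ a) :+ ((b :+ s) :+ (con 0 :+ con 0)))
          ℝ.refl a b (radius y) (p x y) E))

    mixed-lower : ∀ {x y a b} → a ℝ.≈ radius x → b + radius y ℝ.≈ 0# → p x y ≤ dist R a b + E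
    mixed-lower {x} {y} {a} {b} a≈ b+r≈0 = by-adding
      (p≤radius+radius x y ⊕ ≤-reflexive (ℝ.sym a≈) ⊕ ≤-distˡ a b ⊕ ≤-reflexive b+r≈0 ⊕ 0≤E)
      (solve 7 (λ a b r s P δ e → P :+ ((r :+ s) :+ (a :+ ((δ :+ b) :+ (con 0 :+ e)))) :=
          (δ :+ e) :+ (P :+ (r :+ (a :+ ((b :+ s) :+ con 0)))))
        ℝ.refl a b (radius x) (radius y) (p x y) (dist R a b) E)

    signed-upper : ∀ {x y a b} → Signed x a → Signed y b → dist R a b ≤ p x y + E
    signed-upper {x} {y} (inj₁ (_ , a≈)) (inj₁ (_ , b≈)) =
      ≤-trans (≤-reflexive (Line.cong a≈ b≈)) (≤-trans (radius-1-Lipschitz x y) (x≤x+nonNeg 0≤E))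
    signed-upper {x} {y} (inj₂ (_ , a≈)) (inj₂ (_ , b≈)) =
      ≤-trans (dist-neg (negate a≈) (negate b≈)) (≤-trans (radius-1-Lipschitz x y) (x≤x+nonNeg 0≤E))
    signed-upper (inj₁ (o≤x , a≈)) (inj₂ (y≤o , b≈)) = mixed-upper o≤x a≈ y≤o b≈
    signed-upper {x} {y} (inj₂ (x≤o , a≈)) (inj₁ (o≤y , b≈)) =
      ≤-trans (≤-reflexive (Line.sym _ _)) (≤-trans (mixed-upper o≤y b≈ x≤o a≈) (p-sym y x ⊕ ≤-refl))

    signed-lower : ∀ {x y a b} → Signed x a → Signed y b → p x y ≤ dist R a b + E
    signed-lower (inj₁ (o≤x , a≈)) (inj₁ (o≤y , b≈)) =
      ≤-trans (same-side (inj₁ (o≤x , o≤y))) (≤-reflexive (ℝ.sym (Line.cong a≈ b≈)) ⊕ ≤-refl)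
    signed-lower (inj₂ (x≤o , a≈)) (inj₂ (y≤o , b≈)) =
      ≤-trans (same-side (inj₂ (x≤o , y≤o))) (dist-neg a≈ b≈ ⊕ ≤-refl)
    signed-lower (inj₁ (_ , a≈)) (inj₂ (_ , b≈)) = mixed-lower a≈ b≈
    signed-lower {x} {y} (inj₂ (_ , a≈)) (inj₁ (_ , b≈)) =
      ≤-trans (p-sym x y) (≤-trans (mixed-lower b≈ a≈) (≤-reflexive (Line.sym _ _) ⊕ ≤-refl))

    -- For a target `u` on the nonnegative half, `v` is the coordinate of a point found at radius
    -- about `u`. Either the point lies on the intended side, or it lies across `o` and the radius
    -- and `u` are small together.
    close : ∀ {x u v} → 0# ≤ u → radius x ≤ u + D → u ≤ radius x + D →
      v ℝ.≈ radius x ⊎ (v + radius x ℝ.≈ 0# × radius x + u ≤ D + E) → dist R u v ≤ D + E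
    close {x} {u} {v} 0≤u r≤u+D u≤r+D (inj₁ v≈r) = dist-≤
      (by-adding (u≤r+D ⊕ 0≤E ⊕ ≤-reflexive (ℝ.sym v≈r))
        (solve 5 (λ u v r D e → u :+ ((r :+ D) :+ (e :+ v)) := ((D :+ e) :+ v) :+ (u :+ (con 0 :+ r)))
          ℝ.refl u v (radius x) D E))
      (by-adding (r≤u+D ⊕ 0≤E ⊕ ≤-reflexive v≈r)
        (solve 5 (λ u v r D e → v :+ ((u :+ D) :+ (e :+ r)) := ((D :+ e) :+ u) :+ (r :+ (con 0 :+ v)))
          ℝ.refl u v (radius x) D E))
    close {x} {u} {v} 0≤u r≤u+D u≤r+D (inj₂ (v+r≈0 , r+u≤)) = dist-≤
      (by-adding (r+u≤ ⊕ ≤-reflexive (ℝ.sym v+r≈0))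
        (solve 5 (λ u v r D e → u :+ ((D :+ e) :+ (v :+ r)) := ((D :+ e) :+ v) :+ ((r :+ u) :+ con 0))
          ℝ.refl u v (radius x) D E))
      (by-adding (≤-reflexive v+r≈0 ⊕ 0≤radius x ⊕ 0≤+ (0≤+ (0≤D o) 0≤E) 0≤u)
        (solve 5 (λ u v r D e → v :+ (con 0 :+ (r :+ ((D :+ e) :+ u))) :=
            ((D :+ e) :+ u) :+ ((v :+ r) :+ (con 0 :+ con 0)))
          ℝ.refl u v (radius x) D E))

    -- If the point found at radius u on the way to y lies on the other
    -- side of o, then u is small.
    overshoot : ∀ {x y u} → p x y + u ≤ radius y + D → radius x + radius y ≤ p x y + E →
      radius x + u ≤ D + E
    overshoot {x} {y} {u} remaining opposite = by-adding (remaining ⊕ opposite)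
      (solve 6 (λ u r s P D e → (r :+ u) :+ ((s :+ D) :+ (P :+ e)) := (D :+ e) :+ ((P :+ u) :+ (r :+ s)))
        ℝ.refl u (radius x) (radius y) (p x y) D E)

    quasiIsometric-line : (∀ t → ∃[ y ] o ≤ₜ y × t ≤ radius y) → (∀ t → ∃[ y ] y ≤ₜ o × t ≤ radius y) →
      QuasiIsometric M (Line R)
    quasiIsometric-line unbounded-above unbounded-below =
      quasiIsometric (Line R) (record { to = signed ; cong = signed-cong }) {E} {D + E} 0≤E
        (λ x y → signed-upper (signed-Signed x) (signed-Signed y))
        (λ x y → signed-lower (signed-Signed x) (signed-Signed y))
        dense-line
      where
      above : ∀ {t x y} → o ≤ₜ y → p x y + t ≤ radius y + D → ∀ {a} → Signed x a →
        a ℝ.≈ radius x ⊎ (a + radius x ℝ.≈ 0# × radius x + t ≤ D + E)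
      above o≤y remaining (inj₁ (_ , a≈))   = inj₁ a≈
      above o≤y remaining (inj₂ (x≤o , a≈)) = inj₂ (a≈ , overshoot remaining (opposite-sides x≤o o≤y))

      below : ∀ {t x y} → y ≤ₜ o → p x y + t ≤ radius y + D → ∀ {a} → Signed x a →
        - a ℝ.≈ radius x ⊎ (- a + radius x ℝ.≈ 0# × radius x + t ≤ D + E)
      below {x = x} {y} y≤o remaining {a} (inj₁ (o≤x , a≈)) =
        inj₂ (ℝ.trans (ℝ.+-congˡ (ℝ.sym a≈)) (ℝ.-‿inverseˡ a) ,
          overshoot remaining (≤-trans (≤-reflexive (ℝ.+-comm (radius x) (radius y)))
            (≤-trans (opposite-sides y≤o o≤x) (p-sym y x ⊕ ≤-refl))))
      below {x = x} y≤o remaining {a} (inj₂ (_ , a≈)) = inj₁ (begin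
        - a                     ≈⟨ ℝ.+-identityʳ (- a) ⟨
        - a + 0#                ≈⟨ ℝ.+-congˡ a≈ ⟨
        - a + (a + radius x)    ≈⟨ ℝ.+-assoc (- a) a (radius x) ⟨
        (- a + a) + radius x    ≈⟨ ℝ.+-congʳ (ℝ.-‿inverseˡ a) ⟩
        0# + radius x           ≈⟨ ℝ.+-identityˡ (radius x) ⟩
        radius x                ∎)
        where open SetoidReasoning ℝ.setoid

      dense-line : ∀ t → ∃[ x ] dist R t (signed x) ≤ D + E
      dense-line t = case total 0# t of λ
        { (inj₁ 0≤t) →
          let y , o≤y , t≤r = unbounded-above t
              x , r≤t+D , t≤r+D , remaining = point-at-radius 0≤t t≤r
          in x , close 0≤t r≤t+D t≤r+D (above o≤y remaining (signed-Signed x))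
        -- Reflection in 0 reduces a negative target to a nonnegative one, with the two sides of `o`
        -- exchanged.
        ; (inj₂ t≤0) →
          let y , y≤o , -t≤r = unbounded-below (- t)
              x , r≤-t+D , -t≤r+D , remaining = point-at-radius (0≤-neg t≤0) -t≤r
          in x , ≤-trans (dist-neg (ℝ.-‿inverseˡ t) (ℝ.-‿inverseˡ (signed x)))
               (close (0≤-neg t≤0) r≤-t+D -t≤r+D (below y≤o remaining (signed-Signed x)))
        }

    unbounded : ∀ {a} (P : Carrier → Set a) → ¬ (∃[ B ] ∀ y → P y → radius y ≤ B) →
      ∀ t → ∃[ y ] P y × t ≤ radius y
    unbounded P ¬bounded t with em {P = ∃[ y ] P y × t ≤ radius y}
    ... | yes found = found
    ... | no  none  = ⊥-elim (¬bounded (t , λ y Py → ≰⇒≥ em λ t≤r → none (y , Py , t≤r)))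

    bounded⊎ray⊎line : IsBounded M ⊎ QuasiIsometric M (Ray R) ⊎ QuasiIsometric M (Line R)
    bounded⊎ray⊎line with
        em {P = ∃[ B ] ∀ y → ⊤ → radius y ≤ B}
      | em {P = ∃[ B ] ∀ y → o ≤ₜ y → radius y ≤ B}
      | em {P = ∃[ B ] ∀ y → y ≤ₜ o → radius y ≤ B}
    ... | yes (B , bounded) | _ | _ = inj₁ (p-bounded⇒bounded λ x y →
      ≤-trans (p≤radius+radius x y) (bounded x tt ⊕ bounded y tt))
    ... | no ¬bounded | yes (B , above) | _ = inj₂ (inj₁ (quasiIsometric-ray
      (λ {x} {y} _ o≤y → inj₂ (above y o≤y))
      λ t → let y , _ , t≤r = unbounded (λ _ → ⊤) ¬bounded t in y , t≤r))
    ... | no ¬bounded | no _ | yes (B , below) = inj₂ (inj₁ (quasiIsometric-ray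
      (λ {x} {y} x≤o _ → inj₁ (below x x≤o))
      λ t → let y , _ , t≤r = unbounded (λ _ → ⊤) ¬bounded t in y , t≤r))
    ... | no _ | no ¬above | no ¬below =
      inj₂ (inj₂ (quasiIsometric-line (unbounded (o ≤ₜ_) ¬above) (unbounded (_≤ₜ o) ¬below)))

-- Existence and values of breakpoints.

module Breakpoints (em : ∀ {a} → ExcludedMiddle a)
  {ℓ} {R : CompleteOrderedField ℓ} (M : MetricSpace R) where

  private
    module ℝ = CompleteOrderedField R
  open CompleteOrderedField R using (0#; 1#; _+_; _*_; _≤_; _<_; _⁻¹)
  open OrderedField R
  open MetricSpace M
  open Setoid setoid using (refl)
  open Paths M

  least : ∀ {a} (P : ℕ → Set a) → ∃ P → ∃[ n ] P n × (∀ m → P m → n ℕ.≤ m)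
  least P (n , Pn) = <-rec (λ n → P n → ∃[ m ] P m × (∀ k → P k → m ℕ.≤ k)) step n Pn
    where
    step : ∀ n → (∀ {m} → m ℕ.< n → P m → ∃[ m ] P m × (∀ k → P k → m ℕ.≤ k)) →
      P n → ∃[ m ] P m × (∀ k → P k → m ℕ.≤ k)
    step n smaller Pn with em {P = ∃[ m ] m ℕ.< n × P m}
    ... | yes (m , m<n , Pm) = smaller m<n Pm
    ... | no  none = n , Pn , λ m Pm → ℕ.≮⇒≥ λ m<n → none (m , m<n , Pm)

  -- The finite breakpoints of all orders have a least element if there are any. Otherwise no order
  -- breaks anywhere, and `T₀` witnesses the value infinity.
  Br-exists : Order M → ∃ (IsBr M)
  Br-exists T₀ with em {P = ∃[ s ] ∃[ T ] IsBrOf M T [ s ]}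
  ... | yes finite = let s , (T , T-Br) , s-least = least (λ s → ∃[ T ] IsBrOf M T [ s ]) finite in
    [ s ] , (T , T-Br) , λ
      { T′ [ s′ ] T′-Br → [ s-least s′ (T′ , T′-Br) ]≤
      ; T′ ⊤⁺     _     → [ s ] ≤⊤⁺
      }
  ... | no infinite = ⊤⁺ , (T₀ , unbreakable T₀) , λ
      { T′ [ s′ ] T′-Br → ⊥-elim (infinite (s′ , T′ , T′-Br))
      ; T′ ⊤⁺     _     → ⊤⁺ ≤⊤⁺
      }
    where
    unbreakable : ∀ T s → ¬ IsBreaking M T s
    unbreakable T s breaking =
      let s′ , breaking′ , s′-least = least (IsBreaking M T) (s , breaking)
      in infinite (s′ , T , breaking′ , s′-least)

  breaking⇒2≤ : ∀ T s → IsBreaking M T s → 2 ℕ.≤ s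
  breaking⇒2≤ T 0 (() , _)
  breaking⇒2≤ T 1 breaking = ⊥-elim (Ratios.¬breaking-1 T breaking)
  breaking⇒2≤ T (ℕ.suc (ℕ.suc s)) _ = s≤s (s≤s z≤n)

  breaking-2⇒Br-2 : ∀ T → IsBreaking M T 2 → IsBr M [ 2 ]
  breaking-2⇒Br-2 T breaking = (T , breaking , breaking⇒2≤ T) , λ
    { T′ [ s ] T′-Br → [ breaking⇒2≤ T′ s (proj₁ T′-Br) ]≤
    ; T′ ⊤⁺    _     → [ 2 ] ≤⊤⁺
    }

  Br≥3 : ∀ {b} → (∀ T → ¬ IsBreaking M T 2) → IsBr M b → [ 3 ] ≤∞ b
  Br≥3 {⊤⁺} _ _ = [ 3 ] ≤⊤⁺
  Br≥3 {[ s ]} ¬breaking-2 ((T , breaking , _) , _) = [ ℕ.≤∧≢⇒< (breaking⇒2≤ T s breaking)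
    (λ { ≡.refl → ¬breaking-2 T breaking }) ]≤

  -- Matches the bounded case of the trichotomy with the point that (a) excludes.
  bounded⇒point : Carrier → IsBounded M → QuasiIsometric M (Point R)
  bounded⇒point o (B , d≤B) =
    record { to = λ _ → 0# , ℝ.refl ; cong = λ _ → ℝ.refl } ,
    (1# , B , ≤-refl , ≤-trans nonNegative (d≤B o o) , λ x y →
      ≤-+⇒-≤ (≤-trans (1⁻¹*x≤x (d x y)) (≤-trans (d≤B x y)
        (≤-trans (x≤x+nonNeg Line.nonNegative) (≤-reflexive (ℝ.+-comm B _))))) ,
      ≤-trans (≤-reflexive (Line.≈⇒0 ℝ.refl))
        (0≤+ (ℝ.*-nonNeg 0≤1 nonNegative) (≤-trans nonNegative (d≤B o o)))) ,
    0# , λ y → o , ≤-reflexive (Line.≈⇒0 (proj₂ y))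
    where
    module Line = IsGeneralMetric (MetricSpace.isMetric (Line R))
    1⁻¹*x≤x : ∀ x → 1# ⁻¹ * x ≤ x
    1⁻¹*x≤x x = ≤-reflexive (ℝ.trans (ℝ.*-congʳ (ℝ.trans (ℝ.sym (ℝ.*-identityˡ (1# ⁻¹)))
      (ℝ.*-inverseʳ 1# (0<⇒≉0 0<1)))) (ℝ.*-identityˡ x))

  Br≤2⇒bounded⊎ray⊎line : Carrier → (∃[ G ] IsGeodesic {R = R} G × QuasiIsometric M G) →
    ∀ T → IsBreaking M T 2 → IsBounded M ⊎ QuasiIsometric M (Ray R) ⊎ QuasiIsometric M (Line R)
  Br≤2⇒bounded⊎ray⊎line o (G , geodesic , M∼G) T breaking =
    let open CoarselyOrdered em M T G geodesic M∼G
        λ₀ , 0≤λ₀ , convex = Ratios.breaking-2⇒convex T em breaking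
        E , between = coarselyBetween λ₀ 0≤λ₀ convex
    in Coordinate.bounded⊎ray⊎line o E between

  module _ (x₀ : Carrier) {δ} (0<δ : 0# < δ) (discrete : ∀ x y → ¬ x ≈ y → δ ≤ d x y) where

    module _ (T : Order M) {B₁ B₂} (0≤B₁ : 0# ≤ B₁) (0≤B₂ : 0# ≤ B₂) where
      open Order T
      open Ratios T

      coarselyConvex⇒breaking-2 : (∀ {x y z} → x ≤ₜ y → y ≤ₜ z →
        d x y ≤ B₁ * d x z + B₂ × d y z ≤ B₁ * d x z + B₂) → IsBreaking M T 2
      coarselyConvex⇒breaking-2 convex = s≤s z≤n , breaking
        where
        μ : ℝ.Carrier
        -- Distinct points satisfy `δ ≤ d x z`, so `B₂` is at most `B₂ * δ ⁻¹ * d x z`.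
        μ = B₁ + B₂ * δ ⁻¹

        0≤μ : 0# ≤ μ
        0≤μ = 0≤+ 0≤B₁ (ℝ.*-nonNeg 0≤B₂ (⁻¹-nonNeg 0<δ))

        absorb : ∀ {x z} → ¬ x ≈ z → B₁ * d x z + B₂ ≤ μ * d x z
        absorb {x} {z} x≉z = ≤-trans
          (≤-refl ⊕ ≤-trans (≤-reflexive (ℝ.sym (ℝ.*-identityʳ B₂)))
            (0≤B₂ ⊛ ≤-⁻¹* 0<δ (≤-trans (≤-reflexive (ℝ.*-identityʳ δ)) (discrete x z x≉z))))
          (≤-reflexive (solve 4 (λ b c i e → b :* e :+ c :* (i :* e) := (b :+ c :* i) :* e)
            ℝ.refl B₁ B₂ (δ ⁻¹) (d x z)))

        short : ∀ {x y z} → x <ₜ y → y <ₜ z → d x y ≤ μ * d x z × d y z ≤ μ * d x z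
        short x<y@(x≤y , _) y<z@(y≤z , _) =
          ≤-trans (proj₁ (convex x≤y y≤z)) (absorb (<ₜ⇒≉ x<y y<z)) ,
          ≤-trans (proj₂ (convex x≤y y≤z)) (absorb (<ₜ⇒≉ x<y y<z))

        ≤bound⇒<2 : ∀ {r} → r ≤ ratioBound 0≤μ short → r < ℝ.fromℕ 2
        ≤bound⇒<2 r≤ = ≤-<-trans r≤ (ratioBound<2 0≤μ short)

        breaking : ∃[ r ] IsOR M T 2 r × r < ℝ.fromℕ 2
        breaking with em {P = ∃[ x ] ∃[ y ] ¬ x ≈ y}
        ... | yes two@(_ , _ , x≉y) =
          let bound = ratio≤ratioBound 0≤μ short
              r , r-sup = ℝ.complete (IsRatio M T 2) (pair-ratio {2} (s≤s z≤n) x≉y) (_ , bound)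
          in r , inj₁ (two , r-sup) , ≤bound⇒<2 (proj₂ r-sup _ bound)
        -- A one-point space falls under the second clause of `IsOR`, with value 1.
        ... | no ¬two = 1# , inj₂ ((x₀ , single) , ℝ.refl) , ≤bound⇒<2 (1≤ratioBound 0≤μ short)
          where
          single : ∀ y → x₀ ≈ y
          single y with em {P = x₀ ≈ y}
          ... | yes x₀≈y = x₀≈y
          ... | no  x₀≉y = ⊥-elim (¬two (x₀ , y , x₀≉y))

    -- Any order works: the diameter bound is an additive error `B₂`, with `B₁` zero.
    bounded⇒breaking-2 : ∀ T → IsBounded M → IsBreaking M T 2
    bounded⇒breaking-2 T (B , d≤B) = coarselyConvex⇒breaking-2 T ≤-refl 0≤B
      λ {x} {y} {z} _ _ → bound x y x z , bound y z x z
      where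
      0≤B : 0# ≤ B
      0≤B = ≤-trans nonNegative (d≤B x₀ x₀)
      bound : ∀ x y u v → d x y ≤ 0# * d u v + B
      bound x y u v = ≤-trans (d≤B x y)
        (≤-reflexive (ℝ.trans (ℝ.sym (ℝ.+-identityˡ B)) (ℝ.+-congʳ (ℝ.sym (ℝ.zeroˡ (d u v))))))

    module _ (T₀ : Order M) (f : setoid ⟶ₛ MetricSpace.setoid (Line R)) where
      private
        module T₀ = Order T₀
        module Line = IsGeneralMetric (MetricSpace.isMetric (Line R))

      -- Comparing the values of `f` alone gives only a preorder; `T₀` breaks the ties within a
      -- fibre and leaves `f` monotone.
      lexOrder : Order M
      lexOrder = record
        { _≤ₜ_ = λ x y → ×-Lex ℝ._≈_ _≤_ T₀._≤ₜ_ (f ⟨$⟩ x , x) (f ⟨$⟩ y , y)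
        ; isTotalOrder = record
          { isPartialOrder = record
            { isPreorder = record
              { isEquivalence = Setoid.isEquivalence setoid
              ; reflexive = λ x≈y → lex.reflexive (Func.cong f x≈y , x≈y)
              ; trans = lex.trans
              }
            ; antisym = λ x≤y y≤x → proj₂ (lex.antisym x≤y y≤x)
            }
          ; total = lex.total
          }
        }
        where
        module lex = IsTotalOrder (On.isTotalOrder (λ x → f ⟨$⟩ x , x)
          (×-isTotalOrder {_≈₁_ = ℝ._≈_} {_≤₁_ = _≤_} {_≤₂_ = T₀._≤ₜ_}
            (λ _ _ → em) ℝ.isTotalOrder T₀.isTotalOrder))

      open Order lexOrder using (_≤ₜ_)

      lexOrder-monotone : ∀ {x y} → x ≤ₜ y → f ⟨$⟩ x ≤ f ⟨$⟩ y
      lexOrder-monotone (inj₁ (fx≤fy , _)) = fx≤fy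
      lexOrder-monotone (inj₂ (fx≈fy , _)) = ≤-reflexive fx≈fy

      lexOrder-breaking-2 : IsQuasiIsometricEmbedding M (Line R) f → IsBreaking M lexOrder 2
      lexOrder-breaking-2 (C₁ , C₂ , 1≤C₁ , 0≤C₂ , distortion) =
        coarselyConvex⇒breaking-2 lexOrder (ℝ.*-nonNeg 0≤C₁ 0≤C₁) (ℝ.*-nonNeg 0≤C₁ (0≤+ 0≤C₂ 0≤C₂))
          λ {x} {y} {z} x≤y y≤z →
            let fx≤fy = lexOrder-monotone x≤y
                fy≤fz = lexOrder-monotone y≤z
                fx = f ⟨$⟩ x ; fy = f ⟨$⟩ y ; fz = f ⟨$⟩ z
            in pull-back (dist-≤ (≤-trans fx≤fy (0≤⇒≤+ Line.nonNegative)) (≤-trans fy≤fz (≤-distʳ fx fz))) ,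
               pull-back (dist-≤ (≤-trans fy≤fz (0≤⇒≤+ Line.nonNegative))
                 (≤-trans (≤-distʳ fx fz) (≤-refl ⊕ fx≤fy)))
        where
        0<C₁ : 0# < C₁
        0<C₁ = <-≤-trans 0<1 1≤C₁
        0≤C₁ = proj₁ 0<C₁

        0≤⇒≤+ : ∀ {x y} → 0# ≤ y → x ≤ y + x
        0≤⇒≤+ {x} {y} 0≤y = ≤-trans (x≤x+nonNeg 0≤y) (≤-reflexive (ℝ.+-comm x y))

        -- An inequality between distances on the line is read back through the lower estimate on
        -- the left and the upper one on the right, which produces `C₁ * C₁` and `C₁ * (C₂ + C₂)`.
        pull-back : ∀ {x y u v} → dist R (f ⟨$⟩ x) (f ⟨$⟩ y) ≤ dist R (f ⟨$⟩ u) (f ⟨$⟩ v) →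
          d x y ≤ (C₁ * C₁) * d u v + C₁ * (C₂ + C₂)
        pull-back {x} {y} {u} {v} h = ≤-trans
          (⁻¹*-≤ 0<C₁ (≤-trans (-≤⇒≤-+ (proj₁ (distortion x y)))
            (≤-trans h (proj₂ (distortion u v)) ⊕ ≤-refl)))
          (≤-reflexive (solve 3 (λ C D e → C :* ((C :* e :+ D) :+ D) := (C :* C) :* e :+ C :* (D :+ D))
            ℝ.refl C₁ C₂ (d u v)))

    bounded⊎ray⊎line⇒Br-2 : Order M →
      IsBounded M ⊎ QuasiIsometric M (Ray R) ⊎ QuasiIsometric M (Line R) → IsBr M [ 2 ]
    bounded⊎ray⊎line⇒Br-2 T (inj₁ bounded) = breaking-2⇒Br-2 T (bounded⇒breaking-2 T bounded)
    bounded⊎ray⊎line⇒Br-2 T (inj₂ (inj₁ (f , embedding , _))) =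
      breaking-2⇒Br-2 (lexOrder T proj₁∘f) (lexOrder-breaking-2 T proj₁∘f embedding)
      where
      proj₁∘f : setoid ⟶ₛ MetricSpace.setoid (Line R)
      proj₁∘f = record { to = proj₁ ∘ Func.to f ; cong = Func.cong f }
    bounded⊎ray⊎line⇒Br-2 T (inj₂ (inj₂ (f , embedding , _))) =
      breaking-2⇒Br-2 (lexOrder T f) (lexOrder-breaking-2 T f embedding)

lemma4p1 : (∀ {a} → ExcludedMiddle a) → (∀ {a b} → Extensionality a b) →
    ∀ {ℓ} (R : CompleteOrderedField ℓ) →
    (∀ (M : MetricSpace R) → MetricSpace.Carrier M →
    (∃[ G ] IsGeodesic {R = R} G × QuasiIsometric M G) →
    ¬ QuasiIsometric M (Point R) → ¬ QuasiIsometric M (Ray R) → ¬ QuasiIsometric M (Line R) →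
    ∃[ b ] IsBr M b × [ 3 ] ≤∞ b) ×
    (∀ (M : MetricSpace R) → MetricSpace.Carrier M →
    IsUniformlyDiscrete M →
    (∃[ G ] IsGeodesic {R = R} G × QuasiIsometric M G) →
    IsBr M [ 2 ] ⇔ (IsBounded M ⊎ QuasiIsometric M (Ray R) ⊎ QuasiIsometric M (Line R)))
lemma4p1 em ext R =
  (λ M o M∼geodesic ¬point ¬ray ¬line →
    let open Breakpoints em M
        b , b-Br = Br-exists (order M o)
    in b , b-Br , Br≥3 (λ T breaking →
      [ ¬point ∘ bounded⇒point o , [ ¬ray , ¬line ]′ ]′
        (Br≤2⇒bounded⊎ray⊎line o M∼geodesic T breaking)) b-Br) ,
  (λ M o (δ , 0<δ , discrete) M∼geodesic →
    let open Breakpoints em M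
    in mk⇔ (λ ((T , breaking , _) , _) → Br≤2⇒bounded⊎ray⊎line o M∼geodesic T breaking)
           (bounded⊎ray⊎line⇒Br-2 o 0<δ discrete (order M o)))
  where
  -- The base point is the default value of the choice function on the empty subset.
  order : ∀ (M : MetricSpace R) → MetricSpace.Carrier M → Order M
  order M o = record { isTotalOrder = OrderingPrinciple.≼-isTotalOrder em ext (MetricSpace.setoid M) o }
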